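{- Let $G$ and $H$ be two connected graphs, where $G$ is non-trivial (has at least two vertices) and non-complete. Let $r\in\{0,1,2,3\}$ with $r\equiv \kappa(G)\pmod 4$. Then $$\kappa_3(G\circ H)\leq \Big\lfloor \tfrac{4}{3}\kappa_3(G)+r-\tfrac{4}{3}\lceil\tfrac{r}{2}\rceil\Big\rfloor |V(H)|.$$ Moreover, the bound is sharp, i.e., there exist such graphs $G,H$ for which equality holds.
   Context: All graphs are finite, simple and undirected. $\kappa(G)$ denotes the (vertex-)connectivity of $G$. For $S\subseteq V(G)$ with $|S|\ge 2$, an $S$-tree is a subgraph of $G$ that is a tree containing $S$; two $S$-trees $T,T'$ are internally disjoint if $E(T)\cap E(T')=\varnothing$ and $V(T)\cap V(T')=S$. $\kappa(S)$ is the maximum number of pairwise internally disjoint $S$-trees in $G$. For $2\le k\le |V(G)|$, $\kappa_k(G)=\min\{\kappa(S): S\subseteq V(G),\ |S|=k\}$; by convention $\kappa_k(G)=1$ if $G$ is connected with fewer than $k$ vertices, and $\kappa_k(G)=0$ if $G$ is disconnected. $G\circ H$ is the lexicographic product: vertex set $V(G)\times V(H)$, with distinct $(u,v),(u',v')$ adjacent iff either $uu'\in E(G)$, or $u=u'$ and $vv'\in E(H)$. -}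

module Defs where

open import Data.Nat using (ℕ; zero; suc; _+_; _*_; _∸_; _≤_; _<_; _/_; _%_)
open import Data.Bool using (Bool; true; false; _∨_; _∧_)
open import Data.Fin using (Fin; remQuot)
open import Data.Fin.Properties using (_≟_)
open import Data.Fin.Subset using (Subset; _∈_; _⊆_; ∁; ⊤; ∣_∣)
open import Data.List using (List; []; _∷_; length; _∷ʳ_)
open import Data.List.Relation.Unary.Unique.Propositional using (Unique)
open import Data.List.Relation.Unary.Linked using (Linked)
open import Data.Product using (Σ; ∃; _×_; _,_; proj₁; proj₂)
open import Data.Sum using (_⊎_)
open import Relation.Nullary using (¬_; yes; no; does)
open import Relation.Binary.PropositionalEquality using (_≡_; _≢_; refl; sym; cong₂)

record Graph (n : ℕ) : Set where
  field
    adj    : Fin n → Fin n → Bool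
    adj-sym    : ∀ u v → adj u v ≡ adj v u
    adj-irrefl : ∀ u → adj u u ≡ false
open Graph public

data Walk {n : ℕ} (E : Fin n → Fin n → Bool) (X : Subset n) : Fin n → Fin n → Set where
  here : ∀ {x} → x ∈ X → Walk E X x x
  step : ∀ {x y z} → x ∈ X → E x y ≡ true → Walk E X y z → Walk E X x z

ConnectedOn : {n : ℕ} → (Fin n → Fin n → Bool) → Subset n → Set
ConnectedOn E X = ∀ u v → u ∈ X → v ∈ X → Walk E X u v

Connected : {n : ℕ} → Graph n → Set
Connected G = ConnectedOn (adj G) ⊤

Complete : {n : ℕ} → Graph n → Set
Complete G = ∀ u v → u ≢ v → adj G u v ≡ true

Separating : {n : ℕ} → Graph n → Subset n → Set
Separating G S = (∣ ∁ S ∣ ≤ 1) ⊎ (¬ ConnectedOn (adj G) (∁ S))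

IsConnectivity : {n : ℕ} → Graph n → ℕ → Set
IsConnectivity {n} G k =
  (Σ (Subset n) λ S → ∣ S ∣ ≡ k × Separating G S) ×
  (∀ (S : Subset n) → Separating G S → k ≤ ∣ S ∣)

Cycle : {n : ℕ} → (Fin n → Fin n → Bool) → Set
Cycle {n} E = Σ (Fin n) λ x → Σ (List (Fin n)) λ rest →
  (2 ≤ length rest) × Unique (x ∷ rest) ×
  Linked (λ u v → E u v ≡ true) ((x ∷ rest) ∷ʳ x)

record Subgraph {n : ℕ} (G : Graph n) : Set where
  field
    VT     : Subset n
    ET     : Fin n → Fin n → Bool
    ET-sym : ∀ u v → ET u v ≡ ET v u
    ET-adj : ∀ u v → ET u v ≡ true → adj G u v ≡ true
    ET-inˡ : ∀ u v → ET u v ≡ true → u ∈ VT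
open Subgraph public

IsTree : {n : ℕ} {G : Graph n} → Subgraph G → Set
IsTree T = ConnectedOn (ET T) (VT T) × ¬ Cycle (ET T)

IsSTree : {n : ℕ} {G : Graph n} → Subset n → Subgraph G → Set
IsSTree S T = IsTree T × S ⊆ VT T

InternallyDisjoint : {n : ℕ} {G : Graph n} → Subset n → Subgraph G → Subgraph G → Set
InternallyDisjoint S T T' =
  (∀ u v → ET T u v ≡ true → ET T' u v ≡ true → Data.Empty.⊥) ×
  (∀ x → x ∈ VT T → x ∈ VT T' → x ∈ S)
  where import Data.Empty

HasDisjointSTrees : {n : ℕ} → (G : Graph n) → Subset n → ℕ → Set
HasDisjointSTrees G S ℓ =
  Σ (Fin ℓ → Subgraph G) λ T →
    (∀ i → IsSTree S (T i)) ×
    (∀ i j → i ≢ j → InternallyDisjoint S (T i) (T j))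

IsKappaS : {n : ℕ} → Graph n → Subset n → ℕ → Set
IsKappaS G S c = HasDisjointSTrees G S c × (∀ ℓ → HasDisjointSTrees G S ℓ → ℓ ≤ c)

-- κ_k(G) = c, including the conventions for disconnected graphs and
-- connected graphs with fewer than k vertices.
IsKappaK : {n : ℕ} → Graph n → ℕ → ℕ → Set
IsKappaK {n} G k c =
  (¬ Connected G → c ≡ 0) ×
  (Connected G → n < k → c ≡ 1) ×
  (Connected G → k ≤ n →
     (Σ (Subset n) λ S → ∣ S ∣ ≡ k × IsKappaS G S c) ×
     (∀ (S : Subset n) → ∣ S ∣ ≡ k → HasDisjointSTrees G S c))

private
  eqb : {n : ℕ} → Fin n → Fin n → Bool
  eqb u v = does (u ≟ v)

  eqb-sym : {n : ℕ} (u v : Fin n) → eqb u v ≡ eqb v u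
  eqb-sym u v with u ≟ v | v ≟ u
  ... | yes _ | yes _ = refl
  ... | no _  | no _  = refl
  ... | yes p | no q  = Data.Empty.⊥-elim (q (sym p)) where import Data.Empty
  ... | no p  | yes q = Data.Empty.⊥-elim (p (sym q)) where import Data.Empty

  eqb-refl : {n : ℕ} (u : Fin n) → eqb u u ≡ true
  eqb-refl u with u ≟ u
  ... | yes _ = refl
  ... | no p  = Data.Empty.⊥-elim (p refl) where import Data.Empty

  pairAdj : {n m : ℕ} → Graph n → Graph m → Fin n × Fin m → Fin n × Fin m → Bool
  pairAdj G H (u , v) (u' , v') = adj G u u' ∨ (eqb u u' ∧ adj H v v')

  pairSym : {n m : ℕ} (G : Graph n) (H : Graph m) → ∀ p q → pairAdj G H p q ≡ pairAdj G H q p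
  pairSym G H (u , v) (u' , v') =
    cong₂ _∨_ (adj-sym G u u') (cong₂ _∧_ (eqb-sym u u') (adj-sym H v v'))

  pairIrr : {n m : ℕ} (G : Graph n) (H : Graph m) → ∀ p → pairAdj G H p p ≡ false
  pairIrr G H (u , v) rewrite adj-irrefl G u | eqb-refl u | adj-irrefl H v = refl

lexAdj : {n m : ℕ} → Graph n → Graph m → Fin (n * m) → Fin (n * m) → Bool
lexAdj {n} {m} G H x y = pairAdj G H (remQuot {n} m x) (remQuot {n} m y)

_∘ₗ_ : {n m : ℕ} → Graph n → Graph m → Graph (n * m)
G ∘ₗ H = record { adj = lexAdj G H ; adj-sym = λ x y → pairSym G H _ _ ; adj-irrefl = λ x → pairIrr G H _ }

-- The bound ⌊ (4/3) c + r − (4/3) ⌈r/2⌉ ⌋, computed as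
-- ⌊ (4c + 3r − 4⌈r/2⌉) / 3 ⌋ with ⌈r/2⌉ = (r+1)/2.  (For c ≥ 1 and r ≤ 3 the
-- numerator is nonnegative, so truncated subtraction is exact.)
bound : ℕ → ℕ → ℕ
bound c r = ((4 * c + 3 * r) ∸ 4 * ((r + 1) / 2)) / 3

{-# OPTIONS --safe #-}
module Submission where

-- A cut of G of size κ(G) lifts to a cut of G ∘ H of size κ(G)|V(H)|, and disjoint
-- trees spanning both sides of a cut use distinct vertices of it, so
-- κ₃(G ∘ H) ≤ κ(G)|V(H)|.  The bound is then κ₃(G) ≥ 3q + ⌈r/2⌉ for κ(G) = 4q + r.
-- For three terminals, every edge between nonterminals can be deleted or
-- contracted without lowering the number of nonterminals needed to separate
-- terminals (Hind and Oellermann).  Once no such edge is left, each nonterminal is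
-- a star on two or three terminals.  A three-terminal star is a tree by itself;
-- two two-terminal stars of different types form a tree, and counting degrees at
-- the terminals shows that enough of these can be paired up.
-- Only inequalities between natural numbers are wanted in the end, so existence
-- is proved up to double negation.

open import Defs
open import Data.Nat using (ℕ; zero; suc; _+_; _*_; _∸_; _≤_; _<_; _≤?_; z≤n; s≤s; s≤s⁻¹; _⊔_; _⊓_; _/_; _%_)
open import Data.Nat.Properties renaming (_≟_ to _ℕ-≟_) hiding (_≤?_; suc-injective)
open import Data.Product using (Σ; ∃; _×_; _,_; proj₁; proj₂)
open import Relation.Nullary using (¬_)
open import Relation.Binary.PropositionalEquality using (_≡_; _≢_; refl; sym; trans; cong; cong₂; subst; module ≡-Reasoning)
open import Algebra.Properties.CommutativeMonoid.Sum +-0-commutativeMonoid using (sum; sum-cong-≗; ∑-distrib-+; sum-replicate-zero)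
open import Data.Bool using (Bool; true; false; _∧_; _∨_; not; if_then_else_)
import Data.Bool.Properties as Bool
open import Data.Empty using (⊥; ⊥-elim)
open import Data.Fin using (Fin; zero; suc; toℕ; remQuot; combine; _↑ˡ_; _↑ʳ_)
open import Data.Fin.Patterns using (0F; 1F; 2F)
open import Data.Fin.Properties using (_≟_; any?; all?; suc-injective; toℕ<n; toℕ-injective; sequence; remQuot-combine; splitAt-↑ˡ; splitAt-↑ʳ)
open import Data.Fin.Subset using (Subset; ∣_∣; _∈_; _∉_; _⊆_; _-_; ∁; ⁅_⁆; ⊤)
open import Data.Fin.Subset.Properties using (_∈?_; ∈⊤; x∈∁p⇒x∉p; x∉p⇒x∈∁p; p⊆q⇒∣p∣≤∣q∣; ∣⁅x⁆∣≡1; x∈⁅x⁆; ∣p∣≤n; ∣∁p∣≡n∸∣p∣; x∈p∧x≢y⇒x∈p-y; x∈p⇒∣p-x∣<∣p∣)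
open import Data.List using ([]; _∷_; _∷ʳ_)
open import Data.List.Relation.Unary.All using (All; []; _∷_)
open import Data.List.Relation.Unary.AllPairs using (_∷_)
open import Data.List.Relation.Unary.Linked using (Linked; _∷_)
open import Data.Maybe using (Maybe; just; nothing)
open import Data.Maybe.Properties using (just-injective; ≡-dec)
open import Data.Nat.DivMod using (/-monoˡ-≤; m*n/n≡m)
open import Data.Nat.Tactic.RingSolver using (solve-∀)
open import Data.Sum using (_⊎_; inj₁; inj₂)
open import Data.Vec using (_∷_; []; tabulate; lookup; here; there)
open import Data.Vec.Properties using (lookup⇒[]=; []=⇒lookup; lookup∘tabulate; tabulate∘lookup)
open import Effect.Monad using (RawMonad)
open import Function using (_∘_; case_of_)
open import Function.Bundles using (mk⇔)
open import Relation.Binary.Construct.Closure.ReflexiveTransitive using (Star; ε; _◅_; _◅◅_; gmap; reverse)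
open import Relation.Nullary using (Dec; yes; no; does)
open import Relation.Nullary.Decidable using (dec-true; dec-false; does-⇔; _×-dec_; _⊎-dec_; _→-dec_; ¬?; from-yes; decidable-stable; ¬¬-excluded-middle)
open import Relation.Nullary.Negation using (¬¬-Monad)

-- The ratio 3/4 comes from the pairing. If no nonterminal sees all three terminals, the numbers of
-- two-terminal stars of the three types have pairwise sums at least k, one inequality for each
-- terminal. The tight case is k/2 stars of each type, that is 3k/2 stars and hence 3k/4 pairs; odd
-- counts cause the rounding to ⌈r/2⌉. The obstacle to the reduction is an edge between two
-- terminals, which can be neither a nonterminal nor contracted. Nets have no such edges: each is
-- subdivided, and the new vertex takes the index of the third terminal, which is idle as a
-- nonterminal. The net then has separators that use a subdividing vertex where G has only an edge,
-- so its toughness does not follow from κ(G) directly; each such vertex is traded for an end of the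
-- edge.

private variable
  n N : ℕ

-- Indicators, finite sums and removal of an edge

does-sound : {P : Set} (P? : Dec P) → does P? ≡ true → P
does-sound (yes p) _ = p

∧-trueˡ : ∀ {a b} → a ∧ b ≡ true → a ≡ true
∧-trueˡ {true} _ = refl

true≢false : ∀ {a} → a ≡ true → a ≡ false → ⊥
true≢false refl ()

ι : Bool → ℕ
ι true  = 1
ι false = 0

ι-mono : ∀ {a b} → (a ≡ true → b ≡ true) → ι a ≤ ι b
ι-mono {false} h = z≤n
ι-mono {true} {b} h rewrite h refl = ≤-refl

sum-mono : {f g : Fin n → ℕ} → (∀ i → f i ≤ g i) → sum f ≤ sum g
sum-mono {zero}  h = z≤n
sum-mono {suc n} h = +-mono-≤ (h zero) (sum-mono (h ∘ suc))

sum-mono-< : {f g : Fin n → ℕ} → (∀ i → f i ≤ g i) → ∀ j → f j < g j → sum f < sum g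
sum-mono-< h zero    lt = +-mono-<-≤ lt (sum-mono (h ∘ suc))
sum-mono-< h (suc j) lt = +-mono-≤-< (h zero) (sum-mono-< (h ∘ suc) j lt)

sum-positive : {f : Fin n → ℕ} → 0 < sum f → ∃ λ i → 0 < f i
sum-positive {suc n} {f} lt with f zero in eq
... | suc _ = zero , subst (0 <_) (sym eq) (s≤s z≤n)
... | zero  = let i , h = sum-positive {f = f ∘ suc} lt in suc i , h

δ : Fin n → ℕ → Fin n → ℕ
δ j c i = if does (i ≟ j) then c else 0

δ-≡ : (j : Fin n) (c : ℕ) → δ j c j ≡ c
δ-≡ j c rewrite dec-true (j ≟ j) refl = refl

δ-≢ : {i j : Fin n} (c : ℕ) → i ≢ j → δ j c i ≡ 0
δ-≢ {i = i} {j} c i≢j rewrite dec-false (i ≟ j) i≢j = refl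

sum-δ : (j : Fin n) (c : ℕ) → sum (δ j c) ≡ c
sum-δ {suc n} zero c = trans (cong (c +_) (sum-replicate-zero n)) (+-identityʳ c)
sum-δ {suc n} (suc j) c = sum-δ j c

∣tabulate∣ : (f : Fin n → Bool) → ∣ tabulate f ∣ ≡ sum (ι ∘ f)
∣tabulate∣ {zero}  f = refl
∣tabulate∣ {suc n} f with f zero
... | true  = cong suc (∣tabulate∣ (f ∘ suc))
... | false = ∣tabulate∣ (f ∘ suc)

∣p∣≡sum : (p : Subset n) → ∣ p ∣ ≡ sum (ι ∘ lookup p)
∣p∣≡sum p = trans (cong ∣_∣ (sym (tabulate∘lookup p))) (∣tabulate∣ (lookup p))

BoolRel : ℕ → Set
BoolRel n = Fin n → Fin n → Bool

SymmetricRel : BoolRel n → Set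
SymmetricRel E = ∀ u v → E u v ≡ E v u

edges : BoolRel n → ℕ
edges E = sum λ u → sum λ v → ι (E u v)

isPair? : (p q u v : Fin n) → Dec ((u ≡ p × v ≡ q) ⊎ (u ≡ q × v ≡ p))
isPair? p q u v = ((u ≟ p) ×-dec (v ≟ q)) ⊎-dec ((u ≟ q) ×-dec (v ≟ p))

cut : Fin n → Fin n → BoolRel n → BoolRel n
cut p q E u v = E u v ∧ not (does (isPair? p q u v))

module _ (p q : Fin n) (E : BoolRel n) where
  cut-sym : SymmetricRel E → SymmetricRel (cut p q E)
  cut-sym E-sym u v = cong₂ _∧_ (E-sym u v) (cong not (does-⇔ (mk⇔ swap swap) (isPair? p q u v) (isPair? p q v u)))
    where
    swap : ∀ {u v} → (u ≡ p × v ≡ q) ⊎ (u ≡ q × v ≡ p) → (v ≡ p × u ≡ q) ⊎ (v ≡ q × u ≡ p)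
    swap (inj₁ (a , b)) = inj₂ (b , a)
    swap (inj₂ (a , b)) = inj₁ (b , a)

  cut-⊆ : ∀ u v → cut p q E u v ≡ true → E u v ≡ true
  cut-⊆ u v = ∧-trueˡ

  cut-complete : ∀ u v → E u v ≡ true → ¬ ((u ≡ p × v ≡ q) ⊎ (u ≡ q × v ≡ p)) → cut p q E u v ≡ true
  cut-complete u v e ¬pair rewrite e | dec-false (isPair? p q u v) ¬pair = refl

  cut-edges : E p q ≡ true → edges (cut p q E) < edges E
  cut-edges e = sum-mono-< (λ u → sum-mono (mono u)) p (sum-mono-< (mono p) q strict)
    where
    mono : ∀ u v → ι (cut p q E u v) ≤ ι (E u v)
    mono u v = ι-mono (cut-⊆ u v)
    strict : ι (cut p q E p q) < ι (E p q)
    strict rewrite e | dec-true (isPair? p q p q) (inj₁ (refl , refl)) = ≤-refl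

-- Nets and their separations

Terminal : Set
Terminal = Fin 3

-- Terminals lie outside `Fin N` and are never adjacent to each other, so any two can be separated
-- by nonterminals alone. Loops are permitted, since contraction produces them.
record Net (N : ℕ) : Set where
  field
    rel     : Fin N → Fin N → Bool
    rel-sym : ∀ u v → rel u v ≡ rel v u
    att     : Fin N → Terminal → Bool
open Net

side : Bool → ℕ
side false = 0
side true  = 2

Close : ℕ → ℕ → Set
Close a b = a ≤ suc b × b ≤ suc a

-- Labels 0, 1, 2 mean low side, separator, high side; terminals are never in the
-- separator.  No edge joins the two sides exactly when labels are 1-Lipschitz.
record Separation (G : Net N) : Set where
  field
    label    : Fin N → ℕ
    split    : Terminal → Bool
    label≤2  : ∀ u → label u ≤ 2
    rel-lip  : ∀ u v → rel G u v ≡ true → label u ≤ suc (label v)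
    att-lip  : ∀ u t → att G u t ≡ true → Close (label u) (side (split t))
    low      : ∃ λ t → split t ≡ false
    high     : ∃ λ t → split t ≡ true
open Separation

isOne : ℕ → ℕ
isOne 1 = 1
isOne _ = 0

order : {G : Net N} → Separation G → ℕ
order σ = sum (isOne ∘ label σ)

Tough : ℕ → Net N → Set
Tough k G = (σ : Separation G) → k ≤ order σ

side-∨ : ∀ a b → side (a ∨ b) ≡ side a ⊔ side b
side-∨ false b = refl
side-∨ true false = refl
side-∨ true true = refl

side-∧ : ∀ a b → side (a ∧ b) ≡ side a ⊓ side b
side-∧ false b = refl
side-∧ true false = refl
side-∧ true true = refl

side-not : ∀ a → side (not a) ≡ 2 ∸ side a
side-not false = refl
side-not true = refl

isOne-⊔⊓ : ∀ a b → isOne (a ⊔ b) + isOne (a ⊓ b) ≡ isOne a + isOne b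
isOne-⊔⊓ a b with ≤-total a b
... | inj₁ a≤b rewrite m≤n⇒m⊔n≡n a≤b | m≤n⇒m⊓n≡m a≤b = +-comm (isOne b) (isOne a)
... | inj₂ b≤a rewrite m≥n⇒m⊔n≡m b≤a | m≥n⇒m⊓n≡n b≤a = refl

isOne-∸ : ∀ a → isOne (2 ∸ a) ≡ isOne a
isOne-∸ 0 = refl
isOne-∸ 1 = refl
isOne-∸ 2 = refl
isOne-∸ (suc (suc (suc a))) = refl

∸-lip : ∀ a b → b ≤ suc a → 2 ∸ a ≤ suc (2 ∸ b)
∸-lip a b h = ≤-trans (lemma 2 a) (s≤s (∸-monoʳ-≤ 2 h))
  where
  lemma : ∀ c a → c ∸ a ≤ suc (c ∸ suc a)
  lemma c a = subst (λ x → c ∸ a ≤ suc x) (trans (∸-+-assoc c a 1) (cong (c ∸_) (+-comm a 1))) (m≤n+m∸n (c ∸ a) 1)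

mirror : {G : Net N} → Separation G → Separation G
mirror {G = G} σ = record
  { label   = λ u → 2 ∸ label σ u
  ; split   = not ∘ split σ
  ; label≤2 = λ u → m∸n≤m 2 (label σ u)
  ; rel-lip = λ u v e → ∸-lip (label σ u) (label σ v) (rel-lip σ v u (trans (rel-sym G v u) e))
  ; att-lip = λ u t e → let l , r = att-lip σ u t e in
      subst (Close (2 ∸ label σ u)) (sym (side-not (split σ t)))
        (∸-lip (label σ u) (side (split σ t)) r , ∸-lip (side (split σ t)) (label σ u) l)
  ; low     = let t , e = high σ in t , cong not e
  ; high    = let t , e = low σ in t , cong not e
  }

order-mirror : {G : Net N} (σ : Separation G) → order (mirror σ) ≡ order σ
order-mirror σ = sum-cong-≗ (isOne-∸ ∘ label σ)

-- Uncrossing, deletion and contraction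

delete : Fin N → Fin N → Net N → Net N
delete p q G = record
  { rel = cut p q (rel G) ; rel-sym = cut-sym p q (rel G) (rel-sym G) ; att = att G }

module _ (G : Net N) (p q : Fin N) where

  -- Labels are potentials, so crossing separations are uncrossed by taking the
  -- pointwise maximum and minimum.  Where σ′ has label 1 at both p and q, these
  -- are 1-Lipschitz along pq even though σ need not be.
  module _ (σ : Separation (delete p q G)) (σ′ : Separation G)
           (p∈Z : label σ′ p ≡ 1) (q∈Z : label σ′ q ≡ 1) where

    ⊔-rel : ∀ u v → rel G u v ≡ true → label σ u ⊔ label σ′ u ≤ suc (label σ v ⊔ label σ′ v)
    ⊔-rel u v e with isPair? p q u v
    ... | no ¬pair = ⊔-mono-≤ (rel-lip σ u v (cut-complete p q (rel G) u v e ¬pair)) (rel-lip σ′ u v e)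
    ... | yes pair = ≤-trans (⊔-lub (label≤2 σ u) (label≤2 σ′ u))
                       (s≤s (≤-trans (≤-reflexive (sym (one pair))) (m≤n⊔m _ _)))
      where
      one : (u ≡ p × v ≡ q) ⊎ (u ≡ q × v ≡ p) → label σ′ v ≡ 1
      one (inj₁ (_ , refl)) = q∈Z
      one (inj₂ (_ , refl)) = p∈Z

    ⊓-rel : ∀ u v → rel G u v ≡ true → label σ u ⊓ label σ′ u ≤ suc (label σ v ⊓ label σ′ v)
    ⊓-rel u v e with isPair? p q u v
    ... | no ¬pair = ⊓-mono-≤ (rel-lip σ u v (cut-complete p q (rel G) u v e ¬pair)) (rel-lip σ′ u v e)
    ... | yes pair = ≤-trans (m⊓n≤n (label σ u) (label σ′ u)) (≤-trans (≤-reflexive (one pair)) (s≤s z≤n))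
      where
      one : (u ≡ p × v ≡ q) ⊎ (u ≡ q × v ≡ p) → label σ′ u ≡ 1
      one (inj₁ (refl , _)) = p∈Z
      one (inj₂ (refl , _)) = q∈Z

    upper : (∃ λ t → split σ t ≡ false × split σ′ t ≡ false) → Separation G
    upper (t , e , e′) = record
      { label   = λ u → label σ u ⊔ label σ′ u
      ; split   = λ s → split σ s ∨ split σ′ s
      ; label≤2 = λ u → ⊔-lub (label≤2 σ u) (label≤2 σ′ u)
      ; rel-lip = ⊔-rel
      ; att-lip = λ u s e →
          let l , r = att-lip σ u s e ; l′ , r′ = att-lip σ′ u s e in
          subst (Close _) (sym (side-∨ (split σ s) (split σ′ s))) (⊔-mono-≤ l l′ , ⊔-mono-≤ r r′)
      ; low     = t , cong₂ _∨_ e e′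
      ; high    = let s , h = high σ in s , cong (_∨ split σ′ s) h
      }

    lower : (∃ λ t → split σ t ≡ true × split σ′ t ≡ true) → Separation G
    lower (t , e , e′) = record
      { label   = λ u → label σ u ⊓ label σ′ u
      ; split   = λ s → split σ s ∧ split σ′ s
      ; label≤2 = λ u → ≤-trans (m⊓n≤m (label σ u) _) (label≤2 σ u)
      ; rel-lip = ⊓-rel
      ; att-lip = λ u s e →
          let l , r = att-lip σ u s e ; l′ , r′ = att-lip σ′ u s e in
          subst (Close _) (sym (side-∧ (split σ s) (split σ′ s))) (⊓-mono-≤ l l′ , ⊓-mono-≤ r r′)
      ; low     = let s , h = low σ in s , cong (_∧ split σ′ s) h
      ; high    = t , cong₂ _∧_ e e′
      }

    -- Submodularity, here with equality: passing to maximum and minimum preserves the number of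
    -- labels 1 at each vertex. Both results are separations of `G` itself, so each has order at
    -- least `k`, although `σ` only separates the deletion.
    uncross : ∀ {k} → Tough k G →
      (∃ λ t → split σ t ≡ false × split σ′ t ≡ false) →
      (∃ λ t → split σ t ≡ true × split σ′ t ≡ true) →
      k + k ≤ order σ + order σ′
    uncross tough lo hi = ≤-trans (+-mono-≤ (tough (upper lo)) (tough (lower hi)))
      (≤-reflexive (begin
        order (upper lo) + order (lower hi)
          ≡⟨ sym (∑-distrib-+ (isOne ∘ label (upper lo)) (isOne ∘ label (lower hi))) ⟩
        sum (λ u → isOne (label σ u ⊔ label σ′ u) + isOne (label σ u ⊓ label σ′ u))
          ≡⟨ sum-cong-≗ (λ u → isOne-⊔⊓ (label σ u) (label σ′ u)) ⟩
        sum (λ u → isOne (label σ u) + isOne (label σ′ u))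
          ≡⟨ ∑-distrib-+ (isOne ∘ label σ) (isOne ∘ label σ′) ⟩
        order σ + order σ′ ∎))
      where open ≡-Reasoning

  uncross-mirrored : ∀ {k} → Tough k G → (σ : Separation (delete p q G)) (σ′ : Separation G) →
    label σ′ p ≡ 1 → label σ′ q ≡ 1 →
    (∃ λ t → split σ t ≡ false × split σ′ t ≡ true) →
    (∃ λ t → split σ t ≡ true × split σ′ t ≡ false) →
    k + k ≤ order σ + order σ′
  uncross-mirrored {k} tough σ σ′ p∈Z q∈Z (a , σa , σ′a) (b , σb , σ′b) =
    subst (λ x → k + k ≤ order σ + x) (order-mirror σ′)
      (uncross σ (mirror σ′) (cong (2 ∸_) p∈Z) (cong (2 ∸_) q∈Z) tough
        (a , σa , cong not σ′a) (b , σb , cong not σ′b))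

  -- If no terminal is low for both, then a low terminal of either one is high for the other, which
  -- gives the two disagreements required by the mirrored version. The same happens if no terminal
  -- is high for both.
  uncross-any : ∀ {k} → Tough k G → (σ : Separation (delete p q G)) (σ′ : Separation G) →
    label σ′ p ≡ 1 → label σ′ q ≡ 1 → k + k ≤ order σ + order σ′
  uncross-any tough σ σ′ p∈Z q∈Z with low σ | high σ | low σ′ | high σ′
  ... | a , σa | b , σb | c , σ′c | d , σ′d
    with split σ′ a in σ′a | split σ′ b in σ′b | split σ c in σc | split σ d in σd
  ... | false | true | _ | _ = uncross σ σ′ p∈Z q∈Z tough (a , σa , σ′a) (b , σb , σ′b)
  ... | false | false | _ | true = uncross σ σ′ p∈Z q∈Z tough (a , σa , σ′a) (d , σd , σ′d)
  ... | true | true | false | _ = uncross σ σ′ p∈Z q∈Z tough (c , σc , σ′c) (b , σb , σ′b)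
  ... | true | false | _ | _ = uncross-mirrored tough σ σ′ p∈Z q∈Z (a , σa , σ′a) (b , σb , σ′b)
  ... | false | false | _ | false = uncross-mirrored tough σ σ′ p∈Z q∈Z (d , σd , σ′d) (b , σb , σ′b)
  ... | true | true | true | _ = uncross-mirrored tough σ σ′ p∈Z q∈Z (a , σa , σ′a) (c , σc , σ′c)

  merge : Fin N → Fin N
  merge u = if does (u ≟ q) then p else u

  merge-≢ : ∀ {u} → u ≢ q → merge u ≡ u
  merge-≢ {u} u≢q rewrite dec-false (u ≟ q) u≢q = refl

  merge-q : merge q ≡ p
  merge-q rewrite dec-true (q ≟ q) refl = refl

  mergedEdge? : ∀ a b → Dec (∃ λ u → ∃ λ v → merge u ≡ a × merge v ≡ b × rel G u v ≡ true)
  mergedEdge? a b = any? λ u → any? λ v → (merge u ≟ a) ×-dec (merge v ≟ b) ×-dec (rel G u v Bool.≟ true)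

  mergedAtt? : ∀ a t → Dec (∃ λ u → merge u ≡ a × att G u t ≡ true)
  mergedAtt? a t = any? λ u → (merge u ≟ a) ×-dec (att G u t Bool.≟ true)

  -- The vertex q survives as an isolated vertex.
  contract : Net N
  contract = record
    { rel     = λ a b → does (mergedEdge? a b)
    ; rel-sym = λ a b → does-⇔ (mk⇔ swap swap) (mergedEdge? a b) (mergedEdge? b a)
    ; att     = λ a t → does (mergedAtt? a t)
    }
    where
    swap : ∀ {a b} → (∃ λ u → ∃ λ v → merge u ≡ a × merge v ≡ b × rel G u v ≡ true) →
                     (∃ λ u → ∃ λ v → merge u ≡ b × merge v ≡ a × rel G u v ≡ true)
    swap (u , v , ua , vb , e) = v , u , vb , ua , trans (rel-sym G v u) e

  expand : Separation contract → Separation G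
  expand σ = record
    { label   = label σ ∘ merge
    ; split   = split σ
    ; label≤2 = label≤2 σ ∘ merge
    ; rel-lip = λ u v e → rel-lip σ (merge u) (merge v)
                  (dec-true (mergedEdge? (merge u) (merge v)) (u , v , refl , refl , e))
    ; att-lip = λ u t e → att-lip σ (merge u) t (dec-true (mergedAtt? (merge u) t) (u , refl , e))
    ; low     = low σ
    ; high    = high σ
    }

  -- Only `q` changes its label, and it joins the separator only together with `p`.
  order-expand : (σ : Separation contract) → order (expand σ) ≤ order σ + isOne (label σ p)
  order-expand σ = begin
    order (expand σ)                                     ≤⟨ sum-mono pointwise ⟩
    sum (λ u → isOne (label σ u) + δ q one u)            ≡⟨ ∑-distrib-+ (isOne ∘ label σ) (δ q one) ⟩
    order σ + sum (δ q one)                              ≡⟨ cong (order σ +_) (sum-δ q one) ⟩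
    order σ + one                                        ∎
    where
    open ≤-Reasoning
    one = isOne (label σ p)
    pointwise : ∀ u → isOne (label σ (merge u)) ≤ isOne (label σ u) + δ q one u
    pointwise u with u ≟ q
    ... | yes refl = m≤n+m one _
    ... | no _     = m≤m+n _ 0

  -- Suppose `σ` in the deletion and `σ′` in the contraction both have order below `k`. If `p` is
  -- not in the separator of `σ′`, expanding adds nothing and contradicts the toughness of `G`.
  -- Otherwise the expansion has order at most `k` and its separator contains both `p` and `q`, so
  -- uncrossing it with `σ` makes the total at least `k + k`, while it is smaller. The disjunction
  -- is stated negatively because toughness is not decided.
  delete-or-contract : ∀ {k} → Tough k G → ¬ Tough k (delete p q G) → ¬ Tough k contract → ⊥
  delete-or-contract {k} tough ¬del ¬con =
    ¬del λ σ → ≮⇒≥ λ σ<k → ¬con λ σ′ → ≮⇒≥ λ σ′<k → absurd σ σ<k σ′ σ′<k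
    where
    absurd : (σ : Separation (delete p q G)) → order σ < k → (σ′ : Separation contract) → order σ′ < k → ⊥
    absurd σ σ<k σ′ σ′<k with label σ′ p ℕ-≟ 1
    ... | yes p∈Z = <⇒≱ (+-mono-<-≤ σ<k σ″≤k)
                      (uncross-any tough σ (expand σ′) (label-merge p∈Z p (merge-p)) (label-merge p∈Z q merge-q))
      where
      merge-p : merge p ≡ p
      merge-p with p ≟ q
      ... | yes _ = refl
      ... | no _  = refl
      label-merge : label σ′ p ≡ 1 → ∀ u → merge u ≡ p → label σ′ (merge u) ≡ 1
      label-merge e u h = trans (cong (label σ′) h) e
      σ″≤k : order (expand σ′) ≤ k
      σ″≤k = ≤-trans (order-expand σ′)
        (≤-trans (≤-reflexive (trans (cong (λ x → order σ′ + isOne x) p∈Z) (+-comm (order σ′) 1))) σ′<k)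
    ... | no p∉Z = <⇒≱ σ′<k (≤-trans (tough (expand σ′))
                     (≤-trans (order-expand σ′) (≤-reflexive (trans (cong (order σ′ +_) (zero-at (label σ′ p) p∉Z)) (+-identityʳ _)))))
      where
      zero-at : ∀ a → a ≢ 1 → isOne a ≡ 0
      zero-at 0 _ = refl
      zero-at 1 h = ⊥-elim (h refl)
      zero-at (suc (suc a)) _ = refl

-- Packings as colour classes, and their return from deletion and contraction

module _ (G : Net N) (colour : Fin N → Maybe ℕ) (i : ℕ) where

  -- Terminals carry no colour: they belong to every class, while a nonterminal belongs to at most
  -- one. This is internal disjointness.
  data Step : Fin N ⊎ Terminal → Fin N ⊎ Terminal → Set where
    across : ∀ {u v} → colour u ≡ just i → colour v ≡ just i → rel G u v ≡ true → Step (inj₁ u) (inj₁ v)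
    up     : ∀ {u t} → colour u ≡ just i → att G u t ≡ true → Step (inj₁ u) (inj₂ t)
    down   : ∀ {u t} → colour u ≡ just i → att G u t ≡ true → Step (inj₂ t) (inj₁ u)

  -- `anchor` excludes stray vertices of the colour, so that the whole class together with the
  -- terminals is connected and can serve as the vertex set of a tree.
  record Connecting : Set where
    field
      links  : ∀ s t → Star Step (inj₂ s) (inj₂ t)
      anchor : ∀ u → colour u ≡ just i → ∃ λ t → Star Step (inj₁ u) (inj₂ t)
open Connecting

Packing : Net N → ℕ → Set
Packing {N} G ℓ = Σ (Fin N → Maybe ℕ) λ colour → ∀ i → i < ℓ → Connecting G colour i

delete-packing : ∀ (G : Net N) p q {ℓ} → Packing (delete p q G) ℓ → Packing G ℓ
delete-packing G p q (colour , conn) = colour , λ i i<ℓ → record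
  { links  = λ s t → gmap (λ x → x) restore (links (conn i i<ℓ) s t)
  ; anchor = λ u e → let t , w = anchor (conn i i<ℓ) u e in t , gmap (λ x → x) restore w
  }
  where
  restore : ∀ {i x y} → Step (delete p q G) colour i x y → Step G colour i x y
  restore (across c d e) = across c d (cut-⊆ p q (rel G) _ _ e)
  restore (up c e)       = up c e
  restore (down c e)     = down c e

-- `q` inherits the colour of `p`. A walk through the merged vertex may enter at one of the two and
-- leave at the other; the edge `pq` bridges the gap.
contract-packing : ∀ (G : Net N) p q → rel G p q ≡ true → p ≢ q → ∀ {ℓ} →
  Packing (contract G p q) ℓ → Packing G ℓ
contract-packing {N} G p q pq p≢q (colour , conn) = colour ∘ π , λ i i<ℓ → record
  { links  = λ s t → lift⋆ (links (conn i i<ℓ) s t)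
  ; anchor = λ u e → let t , w = anchor (conn i i<ℓ) (π u) e in t , fromRep u e ◅◅ lift⋆ w
  }
  where
  π = merge G p q

  module _ {i : ℕ} where
    _⟿_ : Fin N ⊎ Terminal → Fin N ⊎ Terminal → Set
    _⟿_ = Star (Step G (colour ∘ π) i)

    toRep : ∀ u → colour (π u) ≡ just i → inj₁ (π u) ⟿ inj₁ u
    toRep u c with u ≟ q
    ... | yes refl = across (trans (cong colour (merge-≢ G p q p≢q)) c) (trans (cong colour (merge-q G p q)) c) pq ◅ ε
    ... | no _     = ε

    fromRep : ∀ u → colour (π u) ≡ just i → inj₁ u ⟿ inj₁ (π u)
    fromRep u c with u ≟ q
    ... | yes refl = across (trans (cong colour (merge-q G p q)) c) (trans (cong colour (merge-≢ G p q p≢q)) c)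
                       (trans (rel-sym G q p) pq) ◅ ε
    ... | no _     = ε

    lift : ∀ {x y} → Step (contract G p q) colour i x y → x ⟿ y
    lift (across {a} {b} ca cb e) with does-sound (mergedEdge? G p q a b) e
    ... | u , v , refl , refl , uv = toRep u ca ◅◅ across ca cb uv ◅ fromRep v cb
    lift (up {a} {t} ca e) with does-sound (mergedAtt? G p q a t) e
    ... | u , refl , ut = toRep u ca ◅◅ up ca ut ◅ ε
    lift (down {a} {t} ca e) with does-sound (mergedAtt? G p q a t) e
    ... | u , refl , ut = down ca ut ◅ fromRep u ca

    lift⋆ : ∀ {x y} → Star (Step (contract G p q) colour i) x y → x ⟿ y
    lift⋆ ε        = ε
    lift⋆ (s ◅ ss) = lift s ◅◅ lift⋆ ss

-- Packing in edgeless nets and in general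

-- treeCount (4q + r) = 3q + ⌈r/2⌉ for r < 4.
treeCount : ℕ → ℕ
treeCount 0 = 0
treeCount 1 = 1
treeCount 2 = 1
treeCount 3 = 2
treeCount (suc (suc (suc (suc k)))) = 3 + treeCount k

treeCount-suc : ∀ k → treeCount (suc k) ≤ suc (treeCount k)
treeCount-suc 0 = ≤-refl
treeCount-suc 1 = s≤s z≤n
treeCount-suc 2 = ≤-refl
treeCount-suc 3 = ≤-refl
treeCount-suc (suc (suc (suc (suc k)))) = +-monoʳ-≤ 3 (treeCount-suc k)

treeCount≤ : ∀ k → treeCount k ≤ k
treeCount≤ zero    = z≤n
treeCount≤ (suc k) = ≤-trans (treeCount-suc k) (s≤s (treeCount≤ k))

-- The terminals to which a nonterminal is attached; those attached to at most
-- one terminal are useless and count as none.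
data Kind : Set where
  all none : Kind
  miss     : Terminal → Kind

_≟ₖ_ : (x y : Kind) → Dec (x ≡ y)
all    ≟ₖ all    = yes refl
all    ≟ₖ none   = no λ ()
all    ≟ₖ miss _ = no λ ()
none   ≟ₖ all    = no λ ()
none   ≟ₖ none   = yes refl
none   ≟ₖ miss _ = no λ ()
miss _ ≟ₖ all    = no λ ()
miss _ ≟ₖ none   = no λ ()
miss i ≟ₖ miss j with i ≟ j
... | yes refl = yes refl
... | no i≢j   = no λ { refl → i≢j refl }

count : Kind → (Fin N → Kind) → ℕ
count x τ = sum λ u → ι (does (x ≟ₖ τ u))

count-find : ∀ x (τ : Fin N → Kind) → 0 < count x τ → ∃ λ v → τ v ≡ x
count-find x τ lt with sum-positive {f = λ u → ι (does (x ≟ₖ τ u))} lt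
... | v , h with x ≟ₖ τ v
...   | yes e = v , sym e

clear : Fin N → (Fin N → Kind) → Fin N → Kind
clear v τ u = if does (u ≟ v) then none else τ u

clear-≢ : ∀ v (τ : Fin N → Kind) u → u ≢ v → clear v τ u ≡ τ u
clear-≢ v τ u u≢v rewrite dec-false (u ≟ v) u≢v = refl

clear-kind : ∀ v (τ : Fin N → Kind) u {x} → x ≢ none → clear v τ u ≡ x → u ≢ v × τ u ≡ x
clear-kind v τ u x≢none e with u ≟ v
... | yes _  = ⊥-elim (x≢none (sym e))
... | no u≢v = u≢v , e

count-clear : ∀ x v (τ : Fin N → Kind) → count x τ ≤ suc (count x (clear v τ))
count-clear x v τ = begin
  count x τ                                                ≤⟨ sum-mono pointwise ⟩
  sum (λ u → δ v 1 u + ι (does (x ≟ₖ clear v τ u)))        ≡⟨ ∑-distrib-+ (δ v 1) _ ⟩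
  sum (δ v 1) + count x (clear v τ)                        ≡⟨ cong (_+ count x (clear v τ)) (sum-δ v 1) ⟩
  suc (count x (clear v τ))                                ∎
  where
  open ≤-Reasoning
  ι≤1 : ∀ b → ι b ≤ 1
  ι≤1 true  = ≤-refl
  ι≤1 false = z≤n
  pointwise : ∀ u → ι (does (x ≟ₖ τ u)) ≤ δ v 1 u + ι (does (x ≟ₖ clear v τ u))
  pointwise u with u ≟ v
  ... | yes _ = ≤-trans (ι≤1 _) (m≤m+n 1 _)
  ... | no _  = ≤-refl

count-clear-≢ : ∀ x v (τ : Fin N → Kind) → τ v ≢ x → count x τ ≤ count x (clear v τ)
count-clear-≢ x v τ τv≢x = sum-mono pointwise
  where
  pointwise : ∀ u → ι (does (x ≟ₖ τ u)) ≤ ι (does (x ≟ₖ clear v τ u))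
  pointwise u with u ≟ v
  ... | yes refl rewrite dec-false (x ≟ₖ τ v) (τv≢x ∘ sym) = z≤n
  ... | no _     = ≤-refl

Serves : (Fin N → Kind) → (Fin N → Maybe ℕ) → ℕ → Set
Serves τ colour i =
  (∃ λ w → τ w ≡ all × colour w ≡ just i) ⊎
  (∃ λ w → ∃ λ w′ → ∃ λ j → ∃ λ j′ → j ≢ j′ ×
     (τ w ≡ miss j × colour w ≡ just i) × (τ w′ ≡ miss j′ × colour w′ ≡ just i))

-- A coloured vertex has a kind other than `none`, hence is attached to some terminal; this supplies
-- `anchor`.
Tidy : (Fin N → Kind) → (Fin N → Maybe ℕ) → ℕ → Set
Tidy τ colour ℓ = ∀ u i → colour u ≡ just i → i < ℓ × τ u ≢ none

Colouring : (Fin N → Kind) → ℕ → Set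
Colouring τ ℓ = ∃ λ colour → (∀ i → i < ℓ → Serves τ colour i) × Tidy τ colour ℓ

paint : Fin N → ℕ → (Fin N → Maybe ℕ) → Fin N → Maybe ℕ
paint v i colour u = if does (u ≟ v) then just i else colour u

module _ (v : Fin N) (ℓ : ℕ) (colour : Fin N → Maybe ℕ) where

  paint-≡ : paint v ℓ colour v ≡ just ℓ
  paint-≡ rewrite dec-true (v ≟ v) refl = refl

  paint-≢ : ∀ {u} → u ≢ v → paint v ℓ colour u ≡ colour u
  paint-≢ {u} u≢v rewrite dec-false (u ≟ v) u≢v = refl

  module _ (τ : Fin N → Kind) where

    paint-kept : ∀ w {x i} → x ≢ none → clear v τ w ≡ x × colour w ≡ just i →
                 τ w ≡ x × paint v ℓ colour w ≡ just i
    paint-kept w x≢none (e , c) =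
      let w≢v , e′ = clear-kind v τ w x≢none e in e′ , trans (paint-≢ w≢v) c

    paint-serves : ∀ {i} → Serves (clear v τ) colour i → Serves τ (paint v ℓ colour) i
    paint-serves (inj₁ (w , h)) = inj₁ (w , paint-kept w (λ ()) h)
    paint-serves (inj₂ (w , w′ , j , j′ , j≢j′ , h , h′)) =
      inj₂ (w , w′ , j , j′ , j≢j′ , paint-kept w (λ ()) h , paint-kept w′ (λ ()) h′)

    -- The bound `b` is left free to cover both vertices of a pair: it is `ℓ` when the first is
    -- painted, and `suc ℓ` when the second is, as colour `ℓ` is then already in use.
    paint-tidy : ∀ {b} → τ v ≢ none → b ≤ suc ℓ → Tidy (clear v τ) colour b → Tidy τ (paint v ℓ colour) (suc ℓ)
    paint-tidy used b≤ tidy u i c with u ≟ v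
    ... | yes refl = s≤s (≤-reflexive (just-injective (sym c))) , used
    ... | no u≢v   = let i<b , h = tidy u i c in ≤-trans i<b b≤ , h ∘ trans (clear-≢ v τ u u≢v)

≡⇒≢none : {x y : Kind} → x ≡ y → y ≢ none → x ≢ none
≡⇒≢none refl h = h

use-all : ∀ (τ : Fin N → Kind) v → τ v ≡ all → ∀ {ℓ} → Colouring (clear v τ) ℓ → Colouring τ (suc ℓ)
use-all τ v e {ℓ} (colour , serves , tidy) =
  paint v ℓ colour , serves′ , paint-tidy v ℓ colour τ (≡⇒≢none e λ ()) (n≤1+n ℓ) tidy
  where
  serves′ : ∀ i → i < suc ℓ → Serves τ (paint v ℓ colour) i
  serves′ i i<1+ℓ with m<1+n⇒m<n∨m≡n i<1+ℓ
  ... | inj₁ i<ℓ  = paint-serves v ℓ colour τ (serves i i<ℓ)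
  ... | inj₂ refl = inj₁ (v , e , paint-≡ v ℓ colour)

use-pair : ∀ (τ : Fin N → Kind) v v′ j j′ → j ≢ j′ → τ v ≡ miss j → τ v′ ≡ miss j′ →
  ∀ {ℓ} → Colouring (clear v′ (clear v τ)) ℓ → Colouring τ (suc ℓ)
use-pair {N} τ v v′ j j′ j≢j′ e e′ {ℓ} (colour , serves , tidy) =
  colour″ , serves′ , paint-tidy v ℓ colour′ τ (≡⇒≢none e λ ()) ≤-refl
                        (paint-tidy v′ ℓ colour (clear v τ) (≡⇒≢none e″ λ ()) (n≤1+n ℓ) tidy)
  where
  colour′ = paint v′ ℓ colour
  colour″ = paint v ℓ colour′
  v′≢v : v′ ≢ v
  v′≢v refl = case trans (sym e) e′ of λ { refl → j≢j′ refl }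
  e″ : clear v τ v′ ≡ miss j′
  e″ rewrite dec-false (v′ ≟ v) v′≢v = e′
  serves′ : ∀ i → i < suc ℓ → Serves τ colour″ i
  serves′ i i<1+ℓ with m<1+n⇒m<n∨m≡n i<1+ℓ
  ... | inj₁ i<ℓ  = paint-serves v ℓ colour′ τ (paint-serves v′ ℓ colour (clear v τ) (serves i i<ℓ))
  ... | inj₂ refl = inj₂ (v , v′ , j , j′ , j≢j′ , (e , paint-≡ v ℓ colour′) ,
                      (e′ , trans (paint-≢ v ℓ colour′ v′≢v) (paint-≡ v′ ℓ colour)))

record Paired (τ : Fin N → Kind) (j j′ : Terminal) : Set where
  field
    rest     : Fin N → Kind
    extend   : ∀ {ℓ} → Colouring rest ℓ → Colouring τ (suc ℓ)
    count-j  : count (miss j) τ ≤ suc (count (miss j) rest)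
    count-j′ : count (miss j′) τ ≤ suc (count (miss j′) rest)
    count-≢  : ∀ i → i ≢ j → i ≢ j′ → count (miss i) τ ≤ count (miss i) rest
open Paired

pair : ∀ (τ : Fin N → Kind) j j′ → j ≢ j′ → 0 < count (miss j) τ → 0 < count (miss j′) τ → Paired τ j j′
pair τ j j′ j≢j′ p p′ with count-find (miss j) τ p | count-find (miss j′) τ p′
... | v , e | v′ , e′ = record
  { rest     = clear v′ (clear v τ)
  ; extend   = use-pair τ v v′ j j′ j≢j′ e e′
  ; count-j  = ≤-trans (count-clear (miss j) v τ)
                 (s≤s (count-clear-≢ (miss j) v′ (clear v τ) (other v′ (λ { refl → j≢j′ refl }) e′)))
  ; count-j′ = ≤-trans (count-clear-≢ (miss j′) v τ (λ h → case trans (sym e) h of λ { refl → j≢j′ refl }))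
                 (count-clear (miss j′) v′ (clear v τ))
  ; count-≢  = λ i i≢j i≢j′ → ≤-trans
                 (count-clear-≢ (miss i) v τ (λ h → case trans (sym e) h of λ { refl → i≢j refl }))
                 (count-clear-≢ (miss i) v′ (clear v τ) (other v′ (λ { refl → i≢j′ refl }) e′))
  }
  where
  other : ∀ w {i x} → x ≢ miss i → τ w ≡ x → clear v τ w ≢ miss i
  other w x≢ ew h = x≢ (trans (sym ew) (proj₂ (clear-kind v τ w (λ ()) h)))

pairs-from-two : ∀ t (τ : Fin N → Kind) j j′ → j ≢ j′ →
  t ≤ count (miss j) τ → t ≤ count (miss j′) τ → Colouring τ t
pairs-from-two zero    τ j j′ j≢j′ h h′ = (λ _ → nothing) , (λ _ ()) , λ _ _ ()
pairs-from-two (suc t) τ j j′ j≢j′ h h′ = extend P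
  (pairs-from-two t (rest P) j j′ j≢j′ (s≤s⁻¹ (≤-trans h (count-j P))) (s≤s⁻¹ (≤-trans h′ (count-j′ P))))
  where P = pair τ j j′ j≢j′ (≤-trans (s≤s z≤n) h) (≤-trans (s≤s z≤n) h′)

module _ {N : ℕ} where

  missing : Terminal → (Fin N → Kind) → ℕ
  missing j = count (miss j)

  -- The sum is the number of two-terminal stars attached to the terminal other than `i` and `j`.
  Balanced : ℕ → (Fin N → Kind) → Set
  Balanced d τ = ∀ i j → i ≢ j → d ≤ missing i τ + missing j τ

  large-other : ∀ t {d a b} → t + t ≤ suc d → d ≤ a + b → ¬ (t ≤ a) → t ≤ b
  large-other t 2t≤1+d d≤ t≰a = ≮⇒≥ λ b<t → <⇒≱ (+-mono-<-≤ (≰⇒> t≰a) b<t)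
    (≤-trans 2t≤1+d (≤-trans (s≤s d≤) (≤-reflexive (sym (+-suc _ _)))))

  -- Two counts below `t` would add up to at most 2t - 2, which is less than `d`. So at least two of
  -- the three counts reach `t`, and these two types are paired with each other. For d < 4 the
  -- largest admissible `t` is ⌈d/2⌉.
  pairs-from-large : ∀ t {d} τ → t + t ≤ suc d → Balanced d τ → Colouring τ t
  pairs-from-large t τ 2t≤1+d bal with t ≤? missing 0F τ | t ≤? missing 1F τ
  ... | yes h₀ | yes h₁ = pairs-from-two t τ 0F 1F (λ ()) h₀ h₁
  ... | yes h₀ | no h₁  = pairs-from-two t τ 0F 2F (λ ()) h₀ (large-other t 2t≤1+d (bal 1F 2F λ ()) h₁)
  ... | no h₀  | _      = pairs-from-two t τ 1F 2F (λ ())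
    (large-other t 2t≤1+d (bal 0F 1F λ ()) h₀) (large-other t 2t≤1+d (bal 0F 2F λ ()) h₀)

  -- If one type has at most one star, each other type has at least 3 + d, enough to reach
  -- `treeCount (4 + d)` from these two types alone.
  rich-other : ∀ {d a b} → 4 + d ≤ a + b → ¬ (2 ≤ a) → 3 + treeCount d ≤ b
  rich-other {d} h 2≰a = ≤-trans (+-monoʳ-≤ 3 (treeCount≤ d))
    (s≤s⁻¹ (≤-trans h (+-monoˡ-≤ _ (s≤s⁻¹ (≰⇒> 2≰a)))))

  -- One pair of each of the three types costs two vertices of every kind.
  pair-triple : ∀ τ → (∀ j → 2 ≤ missing j τ) →
    Σ (Fin N → Kind) λ ρ → (∀ j → missing j τ ≤ 2 + missing j ρ) × (∀ {ℓ} → Colouring ρ ℓ → Colouring τ (3 + ℓ))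
  pair-triple τ two = rest P₃ , bound₃ , λ c → extend P₁ (extend P₂ (extend P₃ c))
    where
    P₁ = pair τ 0F 1F (λ ()) (≤-trans (s≤s z≤n) (two 0F)) (≤-trans (s≤s z≤n) (two 1F))
    P₂ = pair (rest P₁) 1F 2F (λ ()) (s≤s⁻¹ (≤-trans (two 1F) (count-j′ P₁)))
           (≤-trans (s≤s z≤n) (≤-trans (two 2F) (count-≢ P₁ 2F (λ ()) (λ ()))))
    two₀ : missing 0F τ ≤ suc (missing 0F (rest P₂))
    two₀ = ≤-trans (count-j P₁) (s≤s (count-≢ P₂ 0F (λ ()) (λ ())))
    two₂ : missing 2F τ ≤ suc (missing 2F (rest P₂))
    two₂ = ≤-trans (count-≢ P₁ 2F (λ ()) (λ ())) (count-j′ P₂)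
    P₃ = pair (rest P₂) 0F 2F (λ ()) (s≤s⁻¹ (≤-trans (two 0F) two₀)) (s≤s⁻¹ (≤-trans (two 2F) two₂))
    bound₃ : ∀ j → missing j τ ≤ 2 + missing j (rest P₃)
    bound₃ 0F = ≤-trans two₀ (s≤s (count-j P₃))
    bound₃ 1F = ≤-trans (count-j′ P₁) (s≤s (≤-trans (count-j P₂) (s≤s (count-≢ P₃ 1F (λ ()) (λ ())))))
    bound₃ 2F = ≤-trans two₂ (s≤s (count-j′ P₃))

  -- Induction in steps of four. Three pairs, one for each choice of two types, lower every pairwise
  -- sum by at most four, which matches the step of `treeCount`. This fails only if some type has
  -- fewer than two stars, and then the other two are plentiful.
  pairs : ∀ d τ → Balanced d τ → Colouring τ (treeCount d)
  pairs 0 τ bal = pairs-from-large 0 τ z≤n bal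
  pairs 1 τ bal = pairs-from-large 1 τ ≤-refl bal
  pairs 2 τ bal = pairs-from-large 1 τ (n≤1+n 2) bal
  pairs 3 τ bal = pairs-from-large 2 τ ≤-refl bal
  pairs (suc (suc (suc (suc d)))) τ bal with 2 ≤? missing 0F τ | 2 ≤? missing 1F τ | 2 ≤? missing 2F τ
  ... | no h | _ | _ = pairs-from-two _ τ 1F 2F (λ ()) (rich-other (bal 0F 1F λ ()) h) (rich-other (bal 0F 2F λ ()) h)
  ... | _ | no h | _ = pairs-from-two _ τ 0F 2F (λ ()) (rich-other (bal 1F 0F λ ()) h) (rich-other (bal 1F 2F λ ()) h)
  ... | _ | _ | no h = pairs-from-two _ τ 0F 1F (λ ()) (rich-other (bal 2F 0F λ ()) h) (rich-other (bal 2F 1F λ ()) h)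
  ... | yes h₀ | yes h₁ | yes h₂ =
    let ρ , loss , extend³ = pair-triple τ (λ { 0F → h₀ ; 1F → h₁ ; 2F → h₂ })
    in extend³ (pairs d ρ λ i j i≢j → +-cancelˡ-≤ 4 _ _ (≤-trans (bal i j i≢j)
         (≤-trans (+-mono-≤ (loss i) (loss j)) (≤-reflexive (shuffle (missing i ρ) (missing j ρ))))))
    where
    shuffle : ∀ a b → (2 + a) + (2 + b) ≡ 4 + (a + b)
    shuffle a b = cong (2 +_) (trans (+-suc a (suc b)) (cong suc (+-suc a b)))

  AtLeast : ℕ → (Fin N → Kind) → Set
  AtLeast m τ = ∃ λ ℓ → m ≤ ℓ × Colouring τ ℓ

  -- A three-terminal star forms a class alone and uses one unit of degree at each terminal. As
  -- `treeCount` grows by at most one per unit, nothing is lost by spending these stars first.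
  colour-by-degree : ∀ k τ → (∀ i j → i ≢ j → k ≤ count all τ + (missing i τ + missing j τ)) → AtLeast (treeCount k) τ
  colour-by-degree k τ deg with count all τ in eq
  colour-by-degree k τ deg | zero = _ , ≤-refl , pairs k τ deg
  colour-by-degree zero τ deg | suc a = 0 , z≤n , (λ _ → nothing) , (λ _ ()) , λ _ _ ()
  colour-by-degree (suc k) τ deg | suc a =
    let v , e = count-find all τ (subst (0 <_) (sym eq) (s≤s z≤n))
        ℓ , k≤ℓ , c = colour-by-degree k (clear v τ) λ i j i≢j → s≤s⁻¹ (≤-trans (deg i j i≢j)
          (+-mono-≤ (≤-trans (≤-reflexive (sym eq)) (count-clear all v τ))
            (+-mono-≤ (count-clear-≢ (miss i) v τ (λ h → case trans (sym e) h of λ ()))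
                      (count-clear-≢ (miss j) v τ (λ h → case trans (sym e) h of λ ())))))
    in suc ℓ , ≤-trans (treeCount-suc k) (s≤s k≤ℓ) , use-all τ v e c

-- Kinds of nonterminals, and the degrees of an edgeless net

kindOf : Bool → Bool → Bool → Kind
kindOf true  true  true  = all
kindOf false true  true  = miss 0F
kindOf true  false true  = miss 1F
kindOf true  true  false = miss 2F
kindOf _     _     _     = none

kind : Net N → Fin N → Kind
kind G u = kindOf (att G u 0F) (att G u 1F) (att G u 2F)

kindOf-all : ∀ a b c → kindOf a b c ≡ all → a ≡ true × b ≡ true × c ≡ true
kindOf-all true  true  true  e = refl , refl , refl
kindOf-all true  true  false ()
kindOf-all true  false true  ()
kindOf-all true  false false ()
kindOf-all false true  true  ()
kindOf-all false true  false ()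
kindOf-all false false true  ()
kindOf-all false false false ()

kind-all : (G : Net N) → ∀ u → kind G u ≡ all → ∀ t → att G u t ≡ true
kind-all G u e t with kindOf-all (att G u 0F) (att G u 1F) (att G u 2F) e
kind-all G u e 0F | a , b , c = a
kind-all G u e 1F | a , b , c = b
kind-all G u e 2F | a , b , c = c

kind-miss : (G : Net N) → ∀ u j → kind G u ≡ miss j → ∀ t → t ≢ j → att G u t ≡ true
kind-miss G u j e t t≢j with att G u 0F in e₀ | att G u 1F in e₁ | att G u 2F in e₂
kind-miss G u j refl 0F t≢j | false | true | true = ⊥-elim (t≢j refl)
kind-miss G u j refl 1F t≢j | false | true | true = e₁
kind-miss G u j refl 2F t≢j | false | true | true = e₂
kind-miss G u j refl 0F t≢j | true | false | true = e₀
kind-miss G u j refl 1F t≢j | true | false | true = ⊥-elim (t≢j refl)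
kind-miss G u j refl 2F t≢j | true | false | true = e₂
kind-miss G u j refl 0F t≢j | true | true | false = e₀
kind-miss G u j refl 1F t≢j | true | true | false = e₁
kind-miss G u j refl 2F t≢j | true | true | false = ⊥-elim (t≢j refl)

kind-attached : (G : Net N) → ∀ u → kind G u ≢ none → ∃ λ t → att G u t ≡ true
kind-attached G u h with att G u 0F in e₀ | att G u 1F in e₁
... | true  | _     = 0F , e₀
... | false | true  = 1F , e₁
... | false | false = ⊥-elim (h refl)

third : ∀ (i j : Terminal) → ∃ λ t → t ≢ i × t ≢ j
third 0F 0F = 1F , (λ ()) , λ ()
third 0F 1F = 2F , (λ ()) , λ ()
third 0F 2F = 1F , (λ ()) , λ ()
third 1F 0F = 2F , (λ ()) , λ ()
third 1F 1F = 0F , (λ ()) , λ ()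
third 1F 2F = 0F , (λ ()) , λ ()
third 2F 0F = 1F , (λ ()) , λ ()
third 2F 1F = 0F , (λ ()) , λ ()
third 2F 2F = 0F , (λ ()) , λ ()

colouring⇒packing : (G : Net N) → ∀ {ℓ} → Colouring (kind G) ℓ → Packing G ℓ
colouring⇒packing G (colour , serves , tidy) = colour , λ i i<ℓ → record
  { links  = λ s t → links′ (serves i i<ℓ) s t
  ; anchor = λ u c → let t , e = kind-attached G u (proj₂ (tidy u i c)) in t , up c e ◅ ε
  }
  where
  links′ : ∀ {i} → Serves (kind G) colour i → ∀ s t → Star (Step G colour i) (inj₂ s) (inj₂ t)
  links′ (inj₁ (w , e , c)) s t = down c (kind-all G w e s) ◅ up c (kind-all G w e t) ◅ ε
  links′ {i} (inj₂ (w , w′ , j , j′ , j≢j′ , (e , c) , (e′ , c′))) s t with third j j′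
  ... | x , x≢j , x≢j′ = to s ◅◅ from t
    where
    to : ∀ s → Star (Step G colour i) (inj₂ s) (inj₂ x)
    to s with s ≟ j
    ... | no s≢j   = down c (kind-miss G w j e s s≢j) ◅ up c (kind-miss G w j e x x≢j) ◅ ε
    ... | yes refl = down c′ (kind-miss G w′ j′ e′ s j≢j′) ◅ up c′ (kind-miss G w′ j′ e′ x x≢j′) ◅ ε
    from : ∀ s → Star (Step G colour i) (inj₂ x) (inj₂ s)
    from s with s ≟ j
    ... | no s≢j   = down c (kind-miss G w j e x x≢j) ◅ up c (kind-miss G w j e s s≢j) ◅ ε
    ... | yes refl = down c′ (kind-miss G w′ j′ e′ x x≢j′) ◅ up c′ (kind-miss G w′ j′ e′ s j≢j′) ◅ ε

-- Label of a vertex when terminal t is separated from s and s′ in an edgeless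
-- net; the arguments are its attachments to t, s and s′.
starLabel : Bool → Bool → Bool → ℕ
starLabel false _ _ = 2
starLabel true  b c = if b ∨ c then 1 else 0

module _ (G : Net N) (edgeless : ∀ u v → rel G u v ≡ true → u ≡ v)
         (t s s′ : Terminal) (t≢s : t ≢ s) (cover : ∀ x → x ≡ t ⊎ x ≡ s ⊎ x ≡ s′) where

  isolate : Separation G
  isolate = record
    { label   = lab
    ; split   = λ x → not (does (x ≟ t))
    ; label≤2 = λ u → bounded (att G u t) (att G u s) (att G u s′)
    ; rel-lip = λ u v e → ≤-trans (≤-reflexive (cong lab (edgeless u v e))) (n≤1+n _)
    ; att-lip = lip
    ; low     = t , cong not (dec-true (t ≟ t) refl)
    ; high    = s , cong not (dec-false (s ≟ t) (t≢s ∘ sym))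
    }
    where
    lab : Fin N → ℕ
    lab u = starLabel (att G u t) (att G u s) (att G u s′)
    bounded : ∀ a b c → starLabel a b c ≤ 2
    bounded false b c = ≤-refl
    bounded true true c = s≤s z≤n
    bounded true false true = s≤s z≤n
    bounded true false false = z≤n
    close-t : ∀ a b c → a ≡ true → Close (starLabel a b c) 0
    close-t true true c _ = ≤-refl , z≤n
    close-t true false true _ = ≤-refl , z≤n
    close-t true false false _ = z≤n , z≤n
    close-s : ∀ a b c → b ∨ c ≡ true → Close (starLabel a b c) 2
    close-s false b c _ = n≤1+n 2 , n≤1+n 2
    close-s true b c e rewrite e = s≤s z≤n , ≤-refl
    lip : ∀ u x → att G u x ≡ true → Close (lab u) (side (not (does (x ≟ t))))
    lip u x e with x ≟ t
    ... | yes refl = close-t (att G u t) _ _ e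
    ... | no x≢t with cover x
    ...   | inj₁ x≡t         = ⊥-elim (x≢t x≡t)
    ...   | inj₂ (inj₁ refl) = close-s (att G u t) _ _ (cong (_∨ att G u s′) e)
    ...   | inj₂ (inj₂ refl) = close-s (att G u t) (att G u s) _ (trans (cong (att G u s ∨_) e) (Bool.∨-zeroʳ _))

module _ (G : Net N) (edgeless : ∀ u v → rel G u v ≡ true → u ≡ v) {k : ℕ} (tough : Tough k G) where

  -- With no edges present, separating `t` from both other terminals costs one vertex for every star
  -- that joins `t` to another terminal. These have kind `all`, `miss s` or `miss s′`.
  degree : (t s s′ : Terminal) → t ≢ s → (∀ x → x ≡ t ⊎ x ≡ s ⊎ x ≡ s′) →
    (∀ u → isOne (starLabel (att G u t) (att G u s) (att G u s′)) ≡
           ι (does (all ≟ₖ kind G u)) + (ι (does (miss s ≟ₖ kind G u)) + ι (does (miss s′ ≟ₖ kind G u)))) →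
    k ≤ count all (kind G) + (missing s (kind G) + missing s′ (kind G))
  degree t s s′ t≢s cover local = begin
    k                                ≤⟨ tough (isolate G edgeless t s s′ t≢s cover) ⟩
    sum (λ u → isOne (starLabel (att G u t) (att G u s) (att G u s′))) ≡⟨ sum-cong-≗ local ⟩
    sum (λ u → A u + (B u + C u))    ≡⟨ ∑-distrib-+ A (λ u → B u + C u) ⟩
    sum A + sum (λ u → B u + C u)    ≡⟨ cong (sum A +_) (∑-distrib-+ B C) ⟩
    sum A + (sum B + sum C)          ∎
    where
    open ≤-Reasoning
    A = λ u → ι (does (all ≟ₖ kind G u))
    B = λ u → ι (does (miss s ≟ₖ kind G u))
    C = λ u → ι (does (miss s′ ≟ₖ kind G u))

  degrees : ∀ i j → i ≢ j → k ≤ count all (kind G) + (missing i (kind G) + missing j (kind G))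
  degrees 0F 0F h = ⊥-elim (h refl)
  degrees 1F 1F h = ⊥-elim (h refl)
  degrees 2F 2F h = ⊥-elim (h refl)
  degrees 1F 0F h = subst (λ x → k ≤ count all (kind G) + x) (+-comm (missing 0F (kind G)) _) (degrees 0F 1F λ ())
  degrees 2F 0F h = subst (λ x → k ≤ count all (kind G) + x) (+-comm (missing 0F (kind G)) _) (degrees 0F 2F λ ())
  degrees 2F 1F h = subst (λ x → k ≤ count all (kind G) + x) (+-comm (missing 1F (kind G)) _) (degrees 1F 2F λ ())
  degrees 0F 1F _ = degree 2F 0F 1F (λ ()) (λ { 0F → inj₂ (inj₁ refl) ; 1F → inj₂ (inj₂ refl) ; 2F → inj₁ refl })
    λ u → table (att G u 0F) (att G u 1F) (att G u 2F)
    where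
    table : ∀ a b c → isOne (starLabel c a b) ≡
      ι (does (all ≟ₖ kindOf a b c)) + (ι (does (miss 0F ≟ₖ kindOf a b c)) + ι (does (miss 1F ≟ₖ kindOf a b c)))
    table true true true = refl
    table true true false = refl
    table true false true = refl
    table true false false = refl
    table false true true = refl
    table false true false = refl
    table false false true = refl
    table false false false = refl
  degrees 0F 2F _ = degree 1F 0F 2F (λ ()) (λ { 0F → inj₂ (inj₁ refl) ; 2F → inj₂ (inj₂ refl) ; 1F → inj₁ refl })
    λ u → table (att G u 0F) (att G u 1F) (att G u 2F)
    where
    table : ∀ a b c → isOne (starLabel b a c) ≡
      ι (does (all ≟ₖ kindOf a b c)) + (ι (does (miss 0F ≟ₖ kindOf a b c)) + ι (does (miss 2F ≟ₖ kindOf a b c)))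
    table true true true = refl
    table true true false = refl
    table true false true = refl
    table true false false = refl
    table false true true = refl
    table false true false = refl
    table false false true = refl
    table false false false = refl
  degrees 1F 2F _ = degree 0F 1F 2F (λ ()) (λ { 1F → inj₂ (inj₁ refl) ; 2F → inj₂ (inj₂ refl) ; 0F → inj₁ refl })
    λ u → table (att G u 0F) (att G u 1F) (att G u 2F)
    where
    table : ∀ a b c → isOne (starLabel a b c) ≡
      ι (does (all ≟ₖ kindOf a b c)) + (ι (does (miss 1F ≟ₖ kindOf a b c)) + ι (does (miss 2F ≟ₖ kindOf a b c)))
    table true true true = refl
    table true true false = refl
    table true false true = refl
    table true false false = refl
    table false true true = refl
    table false true false = refl
    table false false true = refl
    table false false false = refl

  edgeless-packing : ∃ λ ℓ → treeCount k ≤ ℓ × Packing G ℓ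
  edgeless-packing = let ℓ , k≤ℓ , c = colour-by-degree k (kind G) degrees in ℓ , k≤ℓ , colouring⇒packing G c

-- Deletion shrinks the edge set, contraction the set of live vertices.
packing : ∀ {k} L E (G : Net N) (live : Fin N → Bool) →
  (∀ u v → rel G u v ≡ true → live u ≡ true) → sum (ι ∘ live) ≤ L → edges (rel G) ≤ E → Tough k G →
  ¬ ¬ (∃ λ ℓ → treeCount k ≤ ℓ × Packing G ℓ)
packing {N} L E G live alive hL hE tough ¬packing
  with any? (λ p → any? λ q → (rel G p q Bool.≟ true) ×-dec ¬? (p ≟ q))
... | no ¬edge = ¬packing (edgeless-packing G edgeless tough)
  where
  edgeless : ∀ u v → rel G u v ≡ true → u ≡ v
  edgeless u v e with u ≟ v
  ... | yes u≡v = u≡v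
  ... | no u≢v  = ⊥-elim (¬edge (u , v , e , u≢v))
packing {N} L E G live alive hL hE tough ¬packing | yes (p , q , pq , p≢q) =
  delete-or-contract G p q tough (λ t → ¬del E hE t) (λ t → ¬con L hL t)
  where
  live′ : Fin N → Bool
  live′ u = live u ∧ not (does (u ≟ q))

  live′-≢ : ∀ u → live u ≡ true → u ≢ q → live′ u ≡ true
  live′-≢ u h u≢q rewrite h | dec-false (u ≟ q) u≢q = refl

  alive′ : ∀ a b → rel (contract G p q) a b ≡ true → live′ a ≡ true
  alive′ a b e with does-sound (mergedEdge? G p q a b) e
  ... | u , v , refl , _ , uv with u ≟ q
  ...   | yes refl = live′-≢ p (alive p q pq) p≢q
  ...   | no u≢q   = live′-≢ u (alive u v uv) u≢q

  fewer : sum (ι ∘ live′) < sum (ι ∘ live)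
  fewer = sum-mono-< (λ u → ι-mono ∧-trueˡ) q strict
    where
    strict : ι (live′ q) < ι (live q)
    strict rewrite alive q p (trans (rel-sym G q p) pq) | dec-true (q ≟ q) refl = ≤-refl

  ¬del : ∀ E → edges (rel G) ≤ E → ¬ Tough _ (delete p q G)
  ¬del zero    hE t = <⇒≱ (cut-edges p q (rel G) pq) (≤-trans hE z≤n)
  ¬del (suc E) hE t = packing L E (delete p q G) live (λ u v e → alive u v (cut-⊆ p q (rel G) u v e)) hL
    (s≤s⁻¹ (≤-trans (cut-edges p q (rel G) pq) hE)) t
    λ { (ℓ , k≤ℓ , P) → ¬packing (ℓ , k≤ℓ , delete-packing G p q P) }
  ¬con : ∀ L → sum (ι ∘ live) ≤ L → ¬ Tough _ (contract G p q)
  ¬con zero hL _ = <⇒≱ fewer (≤-trans hL z≤n)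
  -- The edge budget restarts here: the recursion is lexicographic, with the live vertices first.
  ¬con (suc L) hL t = packing L _ (contract G p q) live′ alive′ (s≤s⁻¹ (≤-trans fewer hL)) ≤-refl t
    λ { (ℓ , k≤ℓ , P) → ¬packing (ℓ , k≤ℓ , contract-packing G p q pq p≢q P) }

-- Spanning trees

∈-tabulate⁺ : ∀ {f : Fin n → Bool} {u} → f u ≡ true → u ∈ tabulate f
∈-tabulate⁺ {f = f} {u} e = lookup⇒[]= u (tabulate f) (trans (lookup∘tabulate f u) e)

∈-tabulate⁻ : ∀ {f : Fin n → Bool} {u} → u ∈ tabulate f → f u ≡ true
∈-tabulate⁻ {f = f} {u} h = trans (sym (lookup∘tabulate f u)) ([]=⇒lookup h)

Edge : BoolRel n → Fin n → Fin n → Set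
Edge E u v = E u v ≡ true

walk-start : ∀ {E : BoolRel n} {X u v} → Walk E X u v → u ∈ X
walk-start (here h)     = h
walk-start (step h _ _) = h

walk⇒star : ∀ {E : BoolRel n} {X u v} → Walk E X u v → Star (Edge E) u v
walk⇒star (here _)     = ε
walk⇒star (step _ e w) = e ◅ walk⇒star w

star⇒walk : ∀ {E : BoolRel n} {X u v} → (∀ u v → E u v ≡ true → u ∈ X) → Star (Edge E) u v → v ∈ X → Walk E X u v
star⇒walk ends ε v∈X        = here v∈X
star⇒walk ends (e ◅ w) v∈X = step (ends _ _ e) e (star⇒walk ends w v∈X)

walk-invariant : ∀ {E : BoolRel n} {X} (P : Fin n → Set) →
  (∀ u v → u ∈ X → v ∈ X → E u v ≡ true → P u → P v) → ∀ {u v} → Walk E X u v → P u → P v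
walk-invariant P inv (here _)     p = p
walk-invariant P inv (step h e w) p = walk-invariant P inv w (inv _ _ h (walk-start w) e p)

-- Every edge on the rest of the cycle leaves a vertex other than `x` and `y`, so none of them is
-- `xy` in either direction.
bypass : ∀ (E : BoolRel n) x y z rest → Linked (Edge E) (z ∷ (rest ∷ʳ x)) →
  All (x ≢_) (z ∷ rest) → All (y ≢_) (z ∷ rest) → Star (Edge (cut x y E)) z x
bypass E x y z rest linked (x≢z ∷ x∉) (y≢z ∷ y∉) = go rest linked x∉ y∉
  where
  keep : ∀ v → E z v ≡ true → cut x y E z v ≡ true
  keep v e = cut-complete x y E z v e λ where
    (inj₁ (z≡x , _)) → x≢z (sym z≡x)
    (inj₂ (z≡y , _)) → y≢z (sym z≡y)
  go : ∀ rest → Linked (Edge E) (z ∷ (rest ∷ʳ x)) → All (x ≢_) rest → All (y ≢_) rest → Star (Edge (cut x y E)) z x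
  go []         (e ∷ _) _  _  = keep x e ◅ ε
  go (w ∷ rest) (e ∷ l) x∉ y∉ = keep w e ◅ bypass E x y w rest l x∉ y∉

SpanningTree : BoolRel n → Subset n → Set
SpanningTree {n} E X = Σ (BoolRel n) λ F →
  SymmetricRel F × (∀ u v → F u v ≡ true → E u v ≡ true) × ConnectedOn F X × ¬ Cycle F

-- No cycle is searched for. `E` is offered as its own spanning tree; a cycle objecting to this
-- provides an edge whose removal keeps `X` connected, and the recursion continues with one edge
-- less.
spanning-tree : ∀ bound (E : BoolRel n) X → edges E ≤ bound → SymmetricRel E → (∀ u v → E u v ≡ true → u ∈ X) →
  ConnectedOn E X → ¬ ¬ SpanningTree E X
spanning-tree bound E X few E-sym ends conn ¬tree = ¬tree (E , E-sym , (λ _ _ e → e) , conn , acyclic bound few)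
  where
  acyclic : ∀ bound → edges E ≤ bound → ¬ Cycle E
  acyclic _ _ (x , [] , () , _)
  acyclic _ _ (x , y ∷ [] , s≤s () , _)
  acyclic zero few (x , y ∷ z ∷ rest , _ , _ , (xy ∷ _)) = <⇒≱ (cut-edges x y E xy) (≤-trans few z≤n)
  acyclic (suc bound) few (x , y ∷ z ∷ rest , _ , (x≢y ∷ x≢z ∷ x∉) ∷ (y∉ ∷ _) , (xy ∷ yz ∷ linked)) =
    spanning-tree bound F X (s≤s⁻¹ (≤-trans (cut-edges x y E xy) few)) F-sym
      (λ u v e → ends u v (cut-⊆ x y E u v e))
      (λ u v u∈X v∈X → star⇒walk (λ u v e → ends u v (cut-⊆ x y E u v e)) (reroute (walk⇒star (conn u v u∈X v∈X))) v∈X)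
      λ { (T , T-sym , T⊆F , T-conn , T-acyclic) → ¬tree (T , T-sym , (λ u v e → cut-⊆ x y E u v (T⊆F u v e)) , T-conn , T-acyclic) }
    where
    F = cut x y E
    F-sym = cut-sym x y E E-sym
    y⟿x : Star (Edge F) y x
    y⟿x = cut-complete x y E y z yz (λ { (inj₁ (y≡x , _)) → x≢y (sym y≡x) ; (inj₂ (_ , z≡x)) → x≢z (sym z≡x) })
          ◅ bypass E x y z rest linked (x≢z ∷ x∉) y∉
    reroute : ∀ {u v} → Star (Edge E) u v → Star (Edge F) u v
    reroute ε = ε
    reroute (_◅_ {u} {v} e w) with isPair? x y u v
    ... | no ¬pair                  = cut-complete x y E u v e ¬pair ◅ reroute w
    ... | yes (inj₁ (refl , refl)) = reverse (λ {a} {b} h → trans (F-sym b a) h) y⟿x ◅◅ reroute w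
    ... | yes (inj₂ (refl , refl)) = y⟿x ◅◅ reroute w

-- The net of a graph with three terminals

DistinctCover : Set
DistinctCover = ∀ (i j k : Terminal) → i ≢ j → i ≢ k → j ≢ k → ∀ x → x ≡ i ⊎ x ≡ j ⊎ x ≡ k

distinct-cover? : Dec DistinctCover
distinct-cover? = all? λ i → all? λ j → all? λ k →
  ¬? (i ≟ j) →-dec ¬? (i ≟ k) →-dec ¬? (j ≟ k) →-dec all? λ x → (x ≟ i) ⊎-dec (x ≟ j) ⊎-dec (x ≟ k)

abstract
  distinct-cover : DistinctCover
  distinct-cover = from-yes distinct-cover?

module _ (G : Graph n) (s : Terminal → Fin n) (s-inj : ∀ i j → s i ≡ s j → i ≡ j) where

  Term : Fin n → Set
  Term u = ∃ λ t → u ≡ s t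

  abstract
    term? : ∀ u → Dec (Term u)
    term? u = any? λ t → u ≟ s t

  NetEdge : Fin n → Fin n → Set
  NetEdge u v = adj G u v ≡ true × ¬ Term u × ¬ Term v

  netEdge? : ∀ u v → Dec (NetEdge u v)
  netEdge? u v = (adj G u v Bool.≟ true) ×-dec ¬? (term? u) ×-dec ¬? (term? v)

  -- The slot of a terminal is free for use by a nonterminal: it subdivides the
  -- edge between the two other terminals.
  Slot : Fin n → Terminal → Set
  Slot u t = ∃ λ j → ∃ λ j′ → u ≡ s j × j ≢ t × j ≢ j′ × t ≢ j′ × adj G (s t) (s j′) ≡ true

  NetAtt : Fin n → Terminal → Set
  NetAtt u t = (¬ Term u × adj G u (s t) ≡ true) ⊎ Slot u t

  netAtt? : ∀ u t → Dec (NetAtt u t)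
  netAtt? u t = (¬? (term? u) ×-dec (adj G u (s t) Bool.≟ true)) ⊎-dec
    (any? λ j → any? λ j′ → (u ≟ s j) ×-dec ¬? (j ≟ t) ×-dec ¬? (j ≟ j′) ×-dec ¬? (t ≟ j′) ×-dec (adj G (s t) (s j′) Bool.≟ true))

  net : Net n
  net = record
    { rel     = λ u v → does (netEdge? u v)
    ; rel-sym = λ u v → does-⇔ (mk⇔ swap swap) (netEdge? u v) (netEdge? v u)
    ; att     = λ u t → does (netAtt? u t)
    }
    where
    swap : ∀ {u v} → NetEdge u v → NetEdge v u
    swap (e , u∉ , v∉) = trans (adj-sym G _ _) e , v∉ , u∉

  off : (Fin n → ℕ) → Fin n → ℕ
  off f u = if does (term? u) then 0 else f u

  sum-off : ∀ x y z → x ≢ y → x ≢ z → y ≢ z → (f : Fin n → ℕ) →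
    sum f ≡ sum (off f) + (f (s x) + (f (s y) + f (s z)))
  sum-off x y z x≢y x≢z y≢z f = begin
    sum f                                          ≡⟨ sum-cong-≗ pointwise ⟩
    sum (λ u → off f u + (Δ x u + (Δ y u + Δ z u)))    ≡⟨ ∑-distrib-+ (off f) _ ⟩
    sum (off f) + sum (λ u → Δ x u + (Δ y u + Δ z u))  ≡⟨ cong (sum (off f) +_) (∑-distrib-+ (Δ x) _) ⟩
    sum (off f) + (sum (Δ x) + sum (λ u → Δ y u + Δ z u))
      ≡⟨ cong (λ a → sum (off f) + (sum (Δ x) + a)) (∑-distrib-+ (Δ y) (Δ z)) ⟩
    sum (off f) + (sum (Δ x) + (sum (Δ y) + sum (Δ z)))
      ≡⟨ cong (sum (off f) +_) (cong₂ _+_ (sum-δ (s x) _) (cong₂ _+_ (sum-δ (s y) _) (sum-δ (s z) _))) ⟩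
    sum (off f) + (f (s x) + (f (s y) + f (s z)))  ∎
    where
    open ≡-Reasoning
    Δ : Terminal → Fin n → ℕ
    Δ t = δ (s t) (f (s t))
    Δ-≢ : ∀ {t t′} → t′ ≢ t → Δ t (s t′) ≡ 0
    Δ-≢ h = δ-≢ _ (h ∘ s-inj _ _)
    pointwise : ∀ u → f u ≡ off f u + (Δ x u + (Δ y u + Δ z u))
    pointwise u with term? u
    ... | no u∉ rewrite δ-≢ {i = u} (f (s x)) (λ e → u∉ (x , e)) | δ-≢ {i = u} (f (s y)) (λ e → u∉ (y , e))
                      | δ-≢ {i = u} (f (s z)) (λ e → u∉ (z , e)) = sym (+-identityʳ (f u))
    ... | yes (t , refl) with distinct-cover x y z x≢y x≢z y≢z t
    ...   | inj₁ refl rewrite Δ-≢ x≢y | Δ-≢ x≢z = sym (trans (+-identityʳ _) (δ-≡ (s x) _))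
    ...   | inj₂ (inj₁ refl) rewrite Δ-≢ (x≢y ∘ sym) | Δ-≢ y≢z = sym (trans (+-identityʳ _) (δ-≡ (s y) _))
    ...   | inj₂ (inj₂ refl) rewrite Δ-≢ (x≢z ∘ sym) | Δ-≢ (y≢z ∘ sym) = sym (δ-≡ (s z) _)

  -- The three terminal indices are compared only in total, because a removed terminal is paid for
  -- by a slot that sits at a different index.
  sum-compare : ∀ x y z → x ≢ y → x ≢ z → y ≢ z → {f g : Fin n → ℕ} → (∀ u → ¬ Term u → f u ≤ g u) →
    f (s x) + (f (s y) + f (s z)) ≤ g (s x) + (g (s y) + g (s z)) → sum f ≤ sum g
  sum-compare x y z x≢y x≢z y≢z {f} {g} h h′ = begin
    sum f                                          ≡⟨ sum-off x y z x≢y x≢z y≢z f ⟩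
    sum (off f) + (f (s x) + (f (s y) + f (s z)))  ≤⟨ +-mono-≤ (sum-mono pointwise) h′ ⟩
    sum (off g) + (g (s x) + (g (s y) + g (s z)))  ≡⟨ sum-off x y z x≢y x≢z y≢z g ⟨
    sum g                                          ∎
    where
    open ≤-Reasoning
    pointwise : ∀ u → off f u ≤ off g u
    pointwise u with term? u
    ... | yes _ = z≤n
    ... | no u∉ = h u u∉

  -- Toughness of the net

  module _ {k : ℕ} (min : ∀ S → Separating G S → k ≤ ∣ S ∣) where

    -- σ puts one terminal x on the low side and y, z on the high side.  Crossing
    -- edges are paid for by their slots; they are killed by removing x if the low
    -- side has another vertex, and by removing y or z otherwise.
    module _ (σ : Separation net) (x y z : Terminal) (x≢y : x ≢ y) (x≢z : x ≢ z) (y≢z : y ≢ z)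
             (σx : split σ x ≡ false) (σy : split σ y ≡ true) (σz : split σ z ≡ true) where

      lip : ∀ u v → ¬ Term u → ¬ Term v → adj G u v ≡ true → label σ v ≤ suc (label σ u)
      lip u v u∉ v∉ e = rel-lip σ v u (dec-true (netEdge? v u) (trans (adj-sym G v u) e , v∉ , u∉))

      low-att : ∀ u → NetAtt u x → label σ u ≤ 1
      low-att u a = subst (λ b → label σ u ≤ suc (side b)) σx (proj₁ (att-lip σ u x (dec-true (netAtt? u x) a)))

      high-att : ∀ u t → split σ t ≡ true → NetAtt u t → 1 ≤ label σ u
      high-att u t σt a = s≤s⁻¹ (subst (λ b → side b ≤ suc (label σ u)) σt (proj₂ (att-lip σ u t (dec-true (netAtt? u t) a))))

      -- The slot of `t′` subdivides this edge. It is attached to the low terminal `x` and to the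
      -- high terminal `t`, which leaves only the label 1.
      crossing : ∀ t t′ → split σ t ≡ true → x ≢ t → x ≢ t′ → t ≢ t′ → adj G (s x) (s t) ≡ true → label σ (s t′) ≡ 1
      crossing t t′ σt x≢t x≢t′ t≢t′ e = ≤-antisym
        (low-att (s t′) (inj₂ (t′ , t , refl , x≢t′ ∘ sym , t≢t′ ∘ sym , x≢t , e)))
        (high-att (s t′) t σt (inj₂ (t′ , x , refl , t≢t′ ∘ sym , x≢t′ ∘ sym , x≢t ∘ sym , trans (adj-sym G _ _) e)))

      others-high : ∀ t → t ≢ x → split σ t ≡ true
      others-high t t≢x with distinct-cover x y z x≢y x≢z y≢z t
      ... | inj₁ t≡x         = ⊥-elim (t≢x t≡x)
      ... | inj₂ (inj₁ refl) = σy
      ... | inj₂ (inj₂ refl) = σz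

      Z₀ : Fin n → Set
      Z₀ u = ¬ Term u × label σ u ≡ 1

      z₀? : ∀ u → Dec (Z₀ u)
      z₀? u = ¬? (term? u) ×-dec (label σ u ℕ-≟ 1)

      Crosses : Set
      Crosses = adj G (s x) (s y) ≡ true ⊎ adj G (s x) (s z) ≡ true

      crosses? : Dec Crosses
      crosses? = (adj G (s x) (s y) Bool.≟ true) ⊎-dec (adj G (s x) (s z) Bool.≟ true)

      removeLow? : ∀ u → Dec (Z₀ u ⊎ (u ≡ s x × Crosses))
      removeLow? u = z₀? u ⊎-dec ((u ≟ s x) ×-dec crosses?)

      removeHigh? : ∀ u → Dec (Z₀ u ⊎ ∃ λ t → u ≡ s t × adj G (s x) (s t) ≡ true)
      removeHigh? u = z₀? u ⊎-dec any? λ t → (u ≟ s t) ×-dec (adj G (s x) (s t) Bool.≟ true)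

      removed : {P : Fin n → Set} → (∀ u → Dec (P u)) → Subset n
      removed P? = tabulate (does ∘ P?)

      kept : {P : Fin n → Set} (P? : ∀ u → Dec (P u)) → ∀ {u} → u ∈ ∁ (removed P?) → ¬ P u
      kept P? {u} u∈ p = x∈∁p⇒x∉p u∈ (∈-tabulate⁺ (dec-true (P? u) p))

      keep : {P : Fin n → Set} (P? : ∀ u → Dec (P u)) → ∀ {u} → ¬ P u → u ∈ ∁ (removed P?)
      keep P? {u} ¬p = x∉p⇒x∈∁p λ h → ¬p (does-sound (P? u) (∈-tabulate⁻ h))

      -- The separated vertices are `a` and `s y`. An edge leaving the low nonterminals and `s x`
      -- either ends in a nonterminal of label 1, or goes from `s x` to another terminal; in the
      -- latter case `s x` itself is removed.
      low-separating : ∀ a → ¬ Term a → label σ a ≡ 0 → Separating G (removed removeLow?)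
      low-separating a a∉ a-low = inj₂ λ conn →
        case walk-invariant Low closed (conn a (s y) (keep removeLow? a-kept) (keep removeLow? y-kept)) (inj₁ (a∉ , a-low)) of λ where
          (inj₁ (y∉ , _)) → y∉ (y , refl)
          (inj₂ y≡x)      → x≢y (s-inj _ _ (sym y≡x))
        where
        Low : Fin n → Set
        Low u = (¬ Term u × label σ u ≡ 0) ⊎ u ≡ s x
        a-kept : ¬ (Z₀ a ⊎ (a ≡ s x × Crosses))
        a-kept (inj₁ (_ , e)) = case trans (sym e) a-low of λ ()
        a-kept (inj₂ (e , _)) = a∉ (x , e)
        y-kept : ¬ (Z₀ (s y) ⊎ (s y ≡ s x × Crosses))
        y-kept (inj₁ (y∉ , _)) = y∉ (y , refl)
        y-kept (inj₂ (e , _))  = x≢y (s-inj _ _ (sym e))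
        zero-or-one : ∀ {m} → m ≤ 1 → m ≢ 1 → m ≡ 0
        zero-or-one z≤n       h = refl
        zero-or-one (s≤s z≤n) h = ⊥-elim (h refl)
        closed : ∀ u v → u ∈ ∁ (removed removeLow?) → v ∈ ∁ (removed removeLow?) → adj G u v ≡ true → Low u → Low v
        closed u v u∈ v∈ e (inj₁ (u∉ , u-low)) with term? v
        ... | no v∉ = inj₁ (v∉ , zero-or-one (subst (λ m → label σ v ≤ suc m) u-low (lip u v u∉ v∉ e))
                             (λ e → kept removeLow? v∈ (inj₁ (v∉ , e))))
        ... | yes (t , refl) with t ≟ x
        ...   | yes refl = inj₂ refl
        ...   | no t≢x   = case subst (1 ≤_) u-low (high-att u t (others-high t t≢x) (inj₁ (u∉ , e))) of λ ()
        closed u v u∈ v∈ e (inj₂ refl) with term? v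
        ... | no v∉ = inj₁ (v∉ , zero-or-one (low-att v (inj₁ (v∉ , trans (adj-sym G v u) e)))
                             (λ e → kept removeLow? v∈ (inj₁ (v∉ , e))))
        ... | yes (t , refl) with distinct-cover x y z x≢y x≢z y≢z t
        ...   | inj₁ refl        = inj₂ refl
        ...   | inj₂ (inj₁ refl) = ⊥-elim (kept removeLow? u∈ (inj₂ (refl , inj₁ e)))
        ...   | inj₂ (inj₂ refl) = ⊥-elim (kept removeLow? u∈ (inj₂ (refl , inj₂ e)))

      -- All neighbours of `s x` are removed: the nonterminal ones have label at most 1 and not 0.
      -- Either `s x` is thereby cut off from a remaining vertex, or it is the only vertex left,
      -- which also counts as separating.
      high-separating : (∀ a → ¬ Term a → label σ a ≢ 0) → Separating G (removed removeHigh?)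
      high-separating no-low with any? (λ b → ¬? (removeHigh? b) ×-dec ¬? (b ≟ s x))
      ... | yes (b , b-kept , b≢x) = inj₂ λ conn →
            b≢x (walk-invariant (_≡ s x) closed (conn (s x) b (keep removeHigh? x-kept) (keep removeHigh? b-kept)) refl)
        where
        x-kept : ¬ (Z₀ (s x) ⊎ ∃ λ t → s x ≡ s t × adj G (s x) (s t) ≡ true)
        x-kept (inj₁ (x∉ , _))    = x∉ (x , refl)
        x-kept (inj₂ (t , e , h)) = true≢false (trans (cong (adj G (s x)) e) h) (adj-irrefl G (s x))
        closed : ∀ u v → u ∈ ∁ (removed removeHigh?) → v ∈ ∁ (removed removeHigh?) → adj G u v ≡ true → u ≡ s x → v ≡ s x
        closed u v u∈ v∈ e refl with term? v
        ... | yes (t , refl) = ⊥-elim (kept removeHigh? v∈ (inj₂ (t , refl , e)))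
        ... | no v∉ = ⊥-elim (kept removeHigh? v∈ (inj₁ (v∉ ,
                ≤-antisym (low-att v (inj₁ (v∉ , trans (adj-sym G v u) e))) (n≢0⇒n>0 (no-low v v∉)))))
      ... | no all-removed = inj₁ (≤-trans (p⊆q⇒∣p∣≤∣q∣ only-x) (≤-reflexive (∣⁅x⁆∣≡1 (s x))))
        where
        only-x : ∀ {u} → u ∈ ∁ (removed removeHigh?) → u ∈ ⁅ s x ⁆
        only-x {u} u∈ with u ≟ s x
        ... | yes refl = x∈⁅x⁆ (s x)
        ... | no u≢x   = ⊥-elim (all-removed (u , kept removeHigh? u∈ , u≢x))

      cost : {P : Fin n → Set} (P? : ∀ u → Dec (P u)) → (∀ u → ¬ Term u → P u → label σ u ≡ 1) →
        ι (does (P? (s x))) + (ι (does (P? (s y))) + ι (does (P? (s z)))) ≤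
        isOne (label σ (s x)) + (isOne (label σ (s y)) + isOne (label σ (s z))) →
        ∣ removed P? ∣ ≤ order σ
      cost P? h h′ = ≤-trans (≤-reflexive (∣tabulate∣ (does ∘ P?))) (sum-compare x y z x≢y x≢z y≢z nonterm h′)
        where
        nonterm : ∀ u → ¬ Term u → ι (does (P? u)) ≤ isOne (label σ u)
        nonterm u u∉ with P? u
        ... | no _  = z≤n
        ... | yes p = ≤-reflexive (cong isOne (sym (h u u∉ p)))

      absent : {P : Set} (P? : Dec P) → ¬ P → ι (does P?) ≡ 0
      absent P? ¬p = cong ι (dec-false P? ¬p)

      ι≤ : {P : Set} (P? : Dec P) {m : ℕ} → (P → 1 ≤ m) → ι (does P?) ≤ m
      ι≤ (no _)  h = z≤n
      ι≤ (yes p) h = h p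

      one≤ : ∀ {m} → m ≡ 1 → 1 ≤ isOne m
      one≤ refl = ≤-refl

      low-cost : ∣ removed removeLow? ∣ ≤ order σ
      low-cost = cost removeLow? (λ { u u∉ (inj₁ (_ , e)) → e ; u u∉ (inj₂ (e , _)) → ⊥-elim (u∉ (x , e)) })
        (≤-trans (≤-reflexive (cong₂ (λ a b → ι (does (removeLow? (s x))) + (a + b)) (gone y (x≢y ∘ sym)) (gone z (x≢z ∘ sym))))
          (≤-trans (≤-reflexive (+-identityʳ _)) (≤-trans x-cost (m≤n+m _ (isOne (label σ (s x)))))))
        where
        gone : ∀ t → t ≢ x → ι (does (removeLow? (s t))) ≡ 0
        gone t t≢x = absent (removeLow? (s t)) λ where
          (inj₁ (t∉ , _)) → t∉ (t , refl)
          (inj₂ (e , _))  → t≢x (s-inj _ _ e)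
        x-cost : ι (does (removeLow? (s x))) ≤ isOne (label σ (s y)) + isOne (label σ (s z))
        x-cost = ι≤ (removeLow? (s x)) λ where
          (inj₁ (x∉ , _))     → ⊥-elim (x∉ (x , refl))
          (inj₂ (_ , inj₁ e)) → ≤-trans (one≤ (crossing y z σy x≢y x≢z y≢z e)) (m≤n+m _ _)
          (inj₂ (_ , inj₂ e)) → ≤-trans (one≤ (crossing z y σz x≢z x≢y (y≢z ∘ sym) e)) (m≤m+n _ _)

      high-cost : ∣ removed removeHigh? ∣ ≤ order σ
      high-cost = cost removeHigh? (λ { u u∉ (inj₁ (_ , e)) → e ; u u∉ (inj₂ (t , e , _)) → ⊥-elim (u∉ (t , e)) })
        (+-mono-≤ (≤-trans (≤-reflexive x-gone) (z≤n {isOne (label σ (s x))}))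
          (≤-trans (+-mono-≤ (ι≤ (removeHigh? (s y)) (one≤ ∘ charge y z σy x≢y x≢z y≢z))
                             (ι≤ (removeHigh? (s z)) (one≤ ∘ charge z y σz x≢z x≢y (y≢z ∘ sym))))
            -- Removing `s y` is paid for by the slot of `z`, and removing `s z` by the slot of `y`;
            -- hence the exchange.
            (≤-reflexive (+-comm (isOne (label σ (s z))) _))))
        where
        x-gone : ι (does (removeHigh? (s x))) ≡ 0
        x-gone = absent (removeHigh? (s x)) λ where
          (inj₁ (x∉ , _))    → x∉ (x , refl)
          (inj₂ (t , e , h)) → true≢false (trans (cong (adj G (s x)) e) h) (adj-irrefl G (s x))
        charge : ∀ t t′ → split σ t ≡ true → x ≢ t → x ≢ t′ → t ≢ t′ →
          (Z₀ (s t) ⊎ ∃ λ r → s t ≡ s r × adj G (s x) (s r) ≡ true) → label σ (s t′) ≡ 1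
        charge t t′ σt a b c (inj₁ (t∉ , _))    = ⊥-elim (t∉ (t , refl))
        charge t t′ σt a b c (inj₂ (r , e , h)) = crossing t t′ σt a b c (trans (cong (adj G (s x)) e) h)

      order-one-low : k ≤ order σ
      order-one-low with any? (λ a → ¬? (term? a) ×-dec (label σ a ℕ-≟ 0))
      ... | yes (a , a∉ , a-low) = ≤-trans (min _ (low-separating a a∉ a-low)) low-cost
      ... | no no-low            = ≤-trans (min _ (high-separating λ a a∉ e → no-low (a , a∉ , e))) high-cost

    order-one-high : (σ : Separation net) (x y z : Terminal) → x ≢ y → x ≢ z → y ≢ z →
      split σ x ≡ true → split σ y ≡ false → split σ z ≡ false → k ≤ order σ
    order-one-high σ x y z x≢y x≢z y≢z σx σy σz = subst (k ≤_) (order-mirror σ)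
      (order-one-low (mirror σ) x y z x≢y x≢z y≢z (cong not σx) (cong not σy) (cong not σz))

    net-tough : Tough k net
    net-tough σ with split σ 0F in e₀ | split σ 1F in e₁ | split σ 2F in e₂
    ... | false | true  | true  = order-one-low σ 0F 1F 2F (λ ()) (λ ()) (λ ()) e₀ e₁ e₂
    ... | true  | false | true  = order-one-low σ 1F 0F 2F (λ ()) (λ ()) (λ ()) e₁ e₀ e₂
    ... | true  | true  | false = order-one-low σ 2F 0F 1F (λ ()) (λ ()) (λ ()) e₂ e₀ e₁
    ... | true  | false | false = order-one-high σ 0F 1F 2F (λ ()) (λ ()) (λ ()) e₀ e₁ e₂
    ... | false | true  | false = order-one-high σ 1F 0F 2F (λ ()) (λ ()) (λ ()) e₁ e₀ e₂
    ... | false | false | true  = order-one-high σ 2F 0F 1F (λ ()) (λ ()) (λ ()) e₂ e₀ e₁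
    ... | false | false | false = ⊥-elim (case high σ of λ where
      (0F , h) → true≢false h e₀
      (1F , h) → true≢false h e₁
      (2F , h) → true≢false h e₂)
    ... | true  | true  | true  = ⊥-elim (case low σ of λ where
      (0F , h) → true≢false e₀ h
      (1F , h) → true≢false e₁ h
      (2F , h) → true≢false e₂ h)

  -- From colour classes to trees of the graph

  module _ (colour : Fin n → Maybe ℕ) (i : ℕ) where

    Col : Fin n → Set
    Col u = colour u ≡ just i

    col? : ∀ u → Dec (Col u)
    col? u = ≡-dec _ℕ-≟_ (colour u) (just i)

    In : Fin n → Set
    In u = Term u ⊎ Col u

    in? : ∀ u → Dec (In u)
    in? u = term? u ⊎-dec col? u

    -- An edge between two terminals belongs to the class that owns its slot, the index of the third
    -- terminal. Otherwise several classes could claim it, since terminals lie in all of them.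
    SlotFree : Fin n → Fin n → Set
    SlotFree u v = ¬ Term u ⊎ ¬ Term v ⊎ (∀ t → u ≢ s t → v ≢ s t → Col (s t))

    TreeEdge : Fin n → Fin n → Set
    TreeEdge u v = adj G u v ≡ true × In u × In v × SlotFree u v

    treeEdge? : ∀ u v → Dec (TreeEdge u v)
    treeEdge? u v = (adj G u v Bool.≟ true) ×-dec in? u ×-dec in? v ×-dec
      (¬? (term? u) ⊎-dec ¬? (term? v) ⊎-dec all? λ t → ¬? (u ≟ s t) →-dec ¬? (v ≟ s t) →-dec col? (s t))

    treeEdge-swap : ∀ {u v} → TreeEdge u v → TreeEdge v u
    treeEdge-swap (e , p , q , c) = trans (adj-sym G _ _) e , q , p , slot c
      where
      slot : ∀ {u v} → SlotFree u v → SlotFree v u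
      slot (inj₁ h)        = inj₂ (inj₁ h)
      slot (inj₂ (inj₁ h)) = inj₁ h
      slot (inj₂ (inj₂ h)) = inj₂ (inj₂ λ t a b → h t b a)

    -- A slot is sent to one end of the edge it subdivides.
    place : Fin n ⊎ Terminal → Fin n
    place (inj₂ t) = s t
    place (inj₁ u) with term? u
    ... | yes (j , _) = s (proj₁ (third j j))
    ... | no _        = u

    place-nonterm : ∀ u → ¬ Term u → place (inj₁ u) ≡ u
    place-nonterm u u∉ with term? u
    ... | yes h = ⊥-elim (u∉ h)
    ... | no _  = refl

    place-up : ∀ u t → Col u → NetAtt u t → Star TreeEdge (place (inj₁ u)) (s t)
    place-up u t c (inj₁ (u∉ , e)) rewrite place-nonterm u u∉ = (e , inj₂ c , inj₁ (t , refl) , inj₁ u∉) ◅ ε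
    place-up u t c (inj₂ (j , j′ , refl , j≢t , j≢j′ , t≢j′ , e)) with term? (s j)
    ... | no h = ⊥-elim (h (j , refl))
    ... | yes (r , er) with s-inj _ _ er
    ...   | refl with third j j
    ...     | w , w≢j , _ with distinct-cover j t j′ j≢t j≢j′ t≢j′ w
    ...       | inj₁ w≡j         = ⊥-elim (w≢j w≡j)
    ...       | inj₂ (inj₁ refl) = ε
    -- The slot was placed at the far end `j′`, so the subdivided edge is traversed in full. Its
    -- slot has index `j`, whose colour is given by `c`.
    ...       | inj₂ (inj₂ refl) = (trans (adj-sym G _ _) e , inj₁ (j′ , refl) , inj₁ (t , refl) , inj₂ (inj₂ slot)) ◅ ε
      where
      slot : ∀ r → s j′ ≢ s r → s t ≢ s r → Col (s r)
      slot r a b with distinct-cover j t j′ j≢t j≢j′ t≢j′ r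
      ... | inj₁ refl        = c
      ... | inj₂ (inj₁ refl) = ⊥-elim (b refl)
      ... | inj₂ (inj₂ refl) = ⊥-elim (a refl)

    place-step : ∀ {x y} → Step net colour i x y → Star TreeEdge (place x) (place y)
    place-step (across {u} {v} c d e) with does-sound (netEdge? u v) e
    ... | uv , u∉ , v∉ rewrite place-nonterm u u∉ | place-nonterm v v∉ = (uv , inj₂ c , inj₂ d , inj₁ u∉) ◅ ε
    place-step (up {u} {t} c e)   = place-up u t c (does-sound (netAtt? u t) e)
    place-step (down {u} {t} c e) = reverse treeEdge-swap (place-up u t c (does-sound (netAtt? u t) e))

    place-star : ∀ {x y} → Star (Step net colour i) x y → Star TreeEdge (place x) (place y)
    place-star ε       = ε
    place-star (e ◅ w) = place-step e ◅◅ place-star w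

    tree-to-0 : Connecting net colour i → ∀ u → In u → Star TreeEdge u (s 0F)
    tree-to-0 conn u (inj₁ (t , refl)) = place-star (links conn t 0F)
    tree-to-0 conn u (inj₂ c) with term? u
    ... | yes (t , refl) = place-star (links conn t 0F)
    ... | no u∉ with anchor conn u c
    ...   | t , w = subst (λ v → Star TreeEdge v (s t)) (place-nonterm u u∉) (place-star w) ◅◅ place-star (links conn t 0F)

    vertices : Subset n
    vertices = tabulate (does ∘ in?)

    treeEdgeᵇ : BoolRel n
    treeEdgeᵇ u v = does (treeEdge? u v)

    tree-ends : ∀ u v → treeEdgeᵇ u v ≡ true → u ∈ vertices
    tree-ends u v e = ∈-tabulate⁺ (dec-true (in? u) (proj₁ (proj₂ (does-sound (treeEdge? u v) e))))

    tree-connected : Connecting net colour i → ConnectedOn treeEdgeᵇ vertices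
    tree-connected conn u v u∈ v∈ = star⇒walk tree-ends
      (gmap (λ x → x) (λ {a} {b} → dec-true (treeEdge? a b)) (to u u∈ ◅◅ reverse treeEdge-swap (to v v∈))) v∈
      where
      to : ∀ u → u ∈ vertices → Star TreeEdge u (s 0F)
      to u u∈ = tree-to-0 conn u (does-sound (in? u) (∈-tabulate⁻ u∈))

    STree : Set
    STree = Σ (Subgraph G) λ T → IsTree T × VT T ≡ vertices × (∀ u v → ET T u v ≡ true → TreeEdge u v)

    class-tree : Connecting net colour i → ¬ ¬ STree
    class-tree conn ¬T = spanning-tree _ treeEdgeᵇ vertices ≤-refl
      (λ u v → does-⇔ (mk⇔ treeEdge-swap treeEdge-swap) (treeEdge? u v) (treeEdge? v u)) tree-ends (tree-connected conn)
      λ { (F , F-sym , F⊆ , F-conn , F-acyclic) → ¬T (record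
        { VT = vertices ; ET = F ; ET-sym = F-sym
        ; ET-adj = λ u v e → proj₁ (does-sound (treeEdge? u v) (F⊆ u v e))
        ; ET-inˡ = λ u v e → tree-ends u v (F⊆ u v e) } ,
        (F-conn , F-acyclic) , refl , λ u v e → does-sound (treeEdge? u v) (F⊆ u v e)) }

  module _ (colour : Fin n → Maybe ℕ) {i i′ : ℕ} (i≢i′ : i ≢ i′) where

    Col-disjoint : ∀ {u} → Col colour i u → Col colour i′ u → ⊥
    Col-disjoint c c′ = i≢i′ (just-injective (trans (sym c) c′))

    In-disjoint : ∀ {u} → In colour i u → In colour i′ u → Term u
    In-disjoint (inj₁ h) _        = h
    In-disjoint (inj₂ _) (inj₁ h) = h
    In-disjoint (inj₂ c) (inj₂ c′) = ⊥-elim (Col-disjoint c c′)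

    -- Both ends of a shared edge lie in two classes and are therefore terminals; then the slot of
    -- the edge would have both colours.
    TreeEdge-disjoint : ∀ {u v} → TreeEdge colour i u v → TreeEdge colour i′ u v → ⊥
    TreeEdge-disjoint (_ , p , q , free) (_ , p′ , q′ , free′) with In-disjoint p p′ | In-disjoint q q′
    ... | j , refl | j′ , refl with third j j′
    ...   | t , t≢j , t≢j′ = Col-disjoint (slot free) (slot free′)
      where
      slot : ∀ {i} → SlotFree colour i (s j) (s j′) → Col colour i (s t)
      slot (inj₁ h)        = ⊥-elim (h (j , refl))
      slot (inj₂ (inj₁ h)) = ⊥-elim (h (j′ , refl))
      slot (inj₂ (inj₂ h)) = h t (t≢j ∘ sym ∘ s-inj _ _) (t≢j′ ∘ sym ∘ s-inj _ _)

-- Disjoint trees and cuts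

¬¬-sequence : {P : Fin n → Set} → (∀ i → ¬ ¬ P i) → ¬ ¬ (∀ i → P i)
¬¬-sequence = sequence (RawMonad.rawApplicative ¬¬-Monad)

enumerate : (S : Subset n) → Σ (Fin ∣ S ∣ → Fin n) λ s →
  (∀ i j → s i ≡ s j → i ≡ j) × (∀ i → s i ∈ S) × (∀ x → x ∈ S → ∃ λ i → x ≡ s i)
enumerate [] = (λ ()) , (λ ()) , (λ ()) , λ _ ()
enumerate (false ∷ S) = let s , inj , sound , complete = enumerate S in
  suc ∘ s , (λ i j e → inj i j (suc-injective e)) , (λ i → there (sound i)) ,
  λ { (suc x) (there h) → let i , e = complete x h in i , cong suc e }
enumerate {suc n} (true ∷ S) with enumerate S
... | s , inj , sound , complete = s′ , inj′ , sound′ , complete′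
  where
  s′ : Fin (suc ∣ S ∣) → Fin (suc n)
  s′ zero    = zero
  s′ (suc i) = suc (s i)
  inj′ : ∀ i j → s′ i ≡ s′ j → i ≡ j
  inj′ zero    zero    _ = refl
  inj′ (suc i) (suc j) e = cong suc (inj i j (suc-injective e))
  sound′ : ∀ i → s′ i ∈ true ∷ S
  sound′ zero    = here
  sound′ (suc i) = there (sound i)
  complete′ : ∀ x → x ∈ true ∷ S → ∃ λ i → x ≡ s′ i
  complete′ zero    here      = zero , refl
  complete′ (suc x) (there h) = let i , e = complete x h in suc i , cong suc e

disjoint-trees : (G : Graph n) {k : ℕ} → (∀ S → Separating G S → k ≤ ∣ S ∣) → ∀ S → ∣ S ∣ ≡ 3 →
  ¬ ¬ (∃ λ ℓ → treeCount k ≤ ℓ × HasDisjointSTrees G S ℓ)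
disjoint-trees {n} G min S ∣S∣≡3 ¬trees with enumerate S
... | s , s-inj , sound , complete rewrite ∣S∣≡3 =
  packing _ _ (net G s s-inj) (λ _ → true) (λ _ _ _ → refl) ≤-refl ≤-refl (net-tough G s s-inj min)
    λ { (ℓ , k≤ℓ , colour , conn) →
      -- Each class yields its tree only under a double negation; as there are finitely many
      -- classes, one double negation suffices for all the trees.
      ¬¬-sequence (λ (i : Fin ℓ) → class-tree G s s-inj colour (toℕ i) (conn (toℕ i) (toℕ<n i)))
        λ T → ¬trees (ℓ , k≤ℓ , proj₁ ∘ T ,
          (λ i → let _ , tree , V , _ = T i in tree , λ {x} x∈S → subst (x ∈_) (sym V)
            (∈-tabulate⁺ (dec-true (in? G s s-inj colour (toℕ i) x) (inj₁ (complete x x∈S))))) ,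
          λ i j i≢j → let _ , _ , V , E = T i ; _ , _ , V′ , E′ = T j ; i≢j′ = i≢j ∘ toℕ-injective in
            (λ u v e e′ → TreeEdge-disjoint G s s-inj colour i≢j′ (E u v e) (E′ u v e′)) ,
            λ x x∈ x∈′ → let t , x≡st = In-disjoint G s s-inj colour i≢j′
                                   (inside colour (toℕ i) x (subst (x ∈_) V x∈)) (inside colour (toℕ j) x (subst (x ∈_) V′ x∈′))
                         in subst (_∈ S) (sym x≡st) (sound t)) }
  where
  inside : ∀ colour i x → x ∈ vertices G s s-inj colour i → In G s s-inj colour i x
  inside colour i x h = does-sound (in? G s s-inj colour i x) (∈-tabulate⁻ h)

treeCount≤κ : (G : Graph n) {k c : ℕ} → (∀ S → Separating G S → k ≤ ∣ S ∣) → ∀ S → ∣ S ∣ ≡ 3 → IsKappaS G S c → treeCount k ≤ c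
treeCount≤κ G {k} {c} min S ∣S∣≡3 (_ , max) = decidable-stable (treeCount k ≤? c) λ ≰ →
  disjoint-trees G min S ∣S∣≡3 λ { (ℓ , k≤ℓ , trees) → ≰ (≤-trans k≤ℓ (max ℓ trees)) }

-- For k = 4q + r both sides equal 12q + 3r + 4⌈r/2⌉. Hence at `c = treeCount k` the numerator of
-- `bound` is exactly 3k.
treeCount-identity : ∀ k → 3 * k + 4 * ((k % 4 + 1) / 2) ≡ 4 * treeCount k + 3 * (k % 4)
treeCount-identity 0 = refl
treeCount-identity 1 = refl
treeCount-identity 2 = refl
treeCount-identity 3 = refl
treeCount-identity (suc (suc (suc (suc k)))) = begin
  3 * (4 + k) + a            ≡⟨ left k a ⟩
  12 + (3 * k + a)           ≡⟨ cong (12 +_) (treeCount-identity k) ⟩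
  12 + (4 * treeCount k + b) ≡⟨ right (treeCount k) b ⟩
  4 * (3 + treeCount k) + b  ∎
  where
  open ≡-Reasoning
  a = 4 * ((k % 4 + 1) / 2)
  b = 3 * (k % 4)
  left : ∀ k a → 3 * (4 + k) + a ≡ 12 + (3 * k + a)
  left = solve-∀
  right : ∀ t b → 12 + (4 * t + b) ≡ 4 * (3 + t) + b
  right = solve-∀

treeCount⇒bound : ∀ k c → treeCount k ≤ c → k ≤ bound c (k % 4)
treeCount⇒bound k c h = begin
  k                ≡⟨ m*n/n≡m k 3 ⟨
  k * 3 / 3        ≤⟨ /-monoˡ-≤ 3 (m+n≤o⇒m≤o∸n (k * 3) room) ⟩
  bound c (k % 4)  ∎
  where
  open ≤-Reasoning
  room : k * 3 + 4 * ((k % 4 + 1) / 2) ≤ 4 * c + 3 * (k % 4)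
  room = begin
    k * 3 + 4 * ((k % 4 + 1) / 2)   ≡⟨ cong (_+ 4 * ((k % 4 + 1) / 2)) (*-comm k 3) ⟩
    3 * k + 4 * ((k % 4 + 1) / 2)   ≡⟨ treeCount-identity k ⟩
    4 * treeCount k + 3 * (k % 4)   ≤⟨ +-monoˡ-≤ (3 * (k % 4)) (*-monoʳ-≤ 4 h) ⟩
    4 * c + 3 * (k % 4)             ∎

-- Counting disjoint trees across a vertex cut

injection⇒≤ : ∀ ℓ (S : Subset n) (h : Fin ℓ → Fin n) → (∀ i j → h i ≡ h j → i ≡ j) → (∀ i → h i ∈ S) → ℓ ≤ ∣ S ∣
injection⇒≤ zero    S h inj h∈ = z≤n
injection⇒≤ (suc ℓ) S h inj h∈ = ≤-trans
  (s≤s (injection⇒≤ ℓ (S - h zero) (h ∘ suc) (λ i j e → suc-injective (inj _ _ e))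
    λ i → x∈p∧x≢y⇒x∈p-y (h∈ (suc i)) λ e → case inj _ _ e of λ ()))
  (x∈p⇒∣p-x∣<∣p∣ (h∈ zero))

-- `Side` is an arbitrary predicate so that it can be reachability from `u`, which is not decided.
record Cut (G : Graph n) : Set₁ where
  field
    separator : Subset n
    Side      : Fin n → Set
    u v       : Fin n
    u∉        : u ∉ separator
    v∉        : v ∉ separator
    u-side    : Side u
    v-side    : ¬ Side v
    closed    : ∀ a b → a ∉ separator → b ∉ separator → adj G a b ≡ true → Side a → Side b

  u≢v : u ≢ v
  u≢v u≡v = v-side (subst Side u≡v u-side)

  -- The second alternative covers cuts leaving only u and v behind; there the
  -- third vertex w lies in the separator and a tree may cross through w itself,
  -- but only by the edge uw.
  trees≤separator : ∀ w S {ℓ} → u ∈ S → v ∈ S → w ∈ S → w ≢ u → w ≢ v → (∀ x → x ∈ S → x ≡ u ⊎ x ≡ v ⊎ x ≡ w) →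
    w ∉ separator ⊎ (∀ x → x ≢ u → x ≢ v → x ∈ separator) → HasDisjointSTrees G S ℓ → ℓ ≤ ∣ separator ∣
  trees≤separator w S {ℓ} u∈S v∈S w∈S w≢u w≢v cover third-vertex (T , isTree , disjoint) =
    injection⇒≤ ℓ separator (λ i → point i (hits i)) (λ i j → injective i j (hits i) (hits j)) (λ i → point∈ i (hits i))
    where
    Hits : Fin ℓ → Set
    Hits i = (∃ λ x → x ∈ VT (T i) × x ∉ S × x ∈ separator) ⊎ (w ∈ separator × ET (T i) u w ≡ true)

    walk : ∀ i → Walk (ET (T i)) (VT (T i)) u v
    walk i = proj₁ (proj₁ (isTree i)) u v (proj₂ (isTree i) u∈S) (proj₂ (isTree i) v∈S)

    hits-outside : ∀ i → w ∉ separator → ¬ (∃ λ x → x ∈ VT (T i) × x ∉ S × x ∈ separator) → ⊥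
    hits-outside i w∉ ¬hit = v-side (walk-invariant Side preserved (walk i) u-side)
      where
      missed : ∀ x → x ∈ VT (T i) → x ∉ separator
      missed x x∈ x∈Z with x ∈? S
      ... | no x∉S = ¬hit (x , x∈ , x∉S , x∈Z)
      ... | yes x∈S with cover x x∈S
      ...   | inj₁ refl        = u∉ x∈Z
      ...   | inj₂ (inj₁ refl) = v∉ x∈Z
      ...   | inj₂ (inj₂ refl) = w∉ x∈Z
      preserved : ∀ a b → a ∈ VT (T i) → b ∈ VT (T i) → ET (T i) a b ≡ true → Side a → Side b
      preserved a b a∈ b∈ e = closed a b (missed a a∈) (missed b b∈) (ET-adj (T i) a b e)

    first-edge : ∀ i {a} → Walk (ET (T i)) (VT (T i)) u a → u ≡ a ⊎ ∃ λ b → ET (T i) u b ≡ true × b ∈ VT (T i)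
    first-edge i (here _)     = inj₁ refl
    first-edge i (step _ e w) = inj₂ (_ , e , walk-start w)

    -- By `closed`, `u` and `v` are not adjacent, and every other vertex is in the separator. So the
    -- first edge of the walk already enters it.
    hits-first : ∀ i → (∀ x → x ≢ u → x ≢ v → x ∈ separator) → Hits i
    hits-first i others with first-edge i (walk i)
    ... | inj₁ u≡v = ⊥-elim (u≢v u≡v)
    ... | inj₂ (b , e , b∈) with b ≟ u | b ≟ v
    ...   | yes refl | _ = ⊥-elim (true≢false (ET-adj (T i) b b e) (adj-irrefl G b))
    ...   | no _ | yes refl = ⊥-elim (v-side (closed u b u∉ v∉ (ET-adj (T i) u b e) u-side))
    ...   | no b≢u | no b≢v with b ∈? S
    ...     | no b∉S = inj₁ (b , b∈ , b∉S , others b b≢u b≢v)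
    ...     | yes b∈S with cover b b∈S
    ...       | inj₁ b≡u         = ⊥-elim (b≢u b≡u)
    ...       | inj₂ (inj₁ b≡v)  = ⊥-elim (b≢v b≡v)
    ...       | inj₂ (inj₂ refl) = inj₂ (others b b≢u b≢v , e)

    hits : ∀ i → Hits i
    hits i = case third-vertex of λ where
      (inj₂ others) → hits-first i others
      (inj₁ w∉) → case any? (λ x → (x ∈? VT (T i)) ×-dec ¬? (x ∈? S) ×-dec (x ∈? separator)) of λ where
        (yes h)   → inj₁ h
        (no ¬hit) → ⊥-elim (hits-outside i w∉ ¬hit)

    point : ∀ i → Hits i → Fin n
    point i (inj₁ (x , _)) = x
    point i (inj₂ _)       = w

    point∈ : ∀ i h → point i h ∈ separator
    point∈ i (inj₁ (_ , _ , _ , h)) = h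
    point∈ i (inj₂ (h , _))         = h

    -- A vertex outside `S` lies in only one tree. The point `w` lies in all of them, but it is
    -- chosen only by a tree that owns the edge `uw`.
    injective : ∀ i j h h′ → point i h ≡ point j h′ → i ≡ j
    injective i j h h′ e with i ≟ j
    ... | yes i≡j = i≡j
    injective i j (inj₁ (x , x∈ , x∉S , _)) (inj₁ (_ , x∈′ , _)) refl | no i≢j = ⊥-elim (x∉S (proj₂ (disjoint i j i≢j) x x∈ x∈′))
    injective i j (inj₁ (x , _ , x∉S , _)) (inj₂ _) refl | no _ = ⊥-elim (x∉S w∈S)
    injective i j (inj₂ _) (inj₁ (x , _ , x∉S , _)) refl | no _ = ⊥-elim (x∉S w∈S)
    injective i j (inj₂ (_ , e)) (inj₂ (_ , e′)) _ | no i≢j = ⊥-elim (proj₁ (disjoint i j i≢j) u w e e′)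

triple? : ∀ (a b c x : Fin n) → Dec (x ≡ a ⊎ x ≡ b ⊎ x ≡ c)
triple? a b c x = (x ≟ a) ⊎-dec (x ≟ b) ⊎-dec (x ≟ c)

triple : Fin n → Fin n → Fin n → Subset n
triple a b c = tabulate (does ∘ triple? a b c)

∈-triple⁺ : ∀ {a b c x : Fin n} → x ≡ a ⊎ x ≡ b ⊎ x ≡ c → x ∈ triple a b c
∈-triple⁺ {a = a} {b} {c} {x} h = ∈-tabulate⁺ (dec-true (triple? a b c x) h)

∈-triple⁻ : ∀ {a b c x : Fin n} → x ∈ triple a b c → x ≡ a ⊎ x ≡ b ⊎ x ≡ c
∈-triple⁻ {a = a} {b} {c} {x} h = does-sound (triple? a b c x) (∈-tabulate⁻ h)

∣triple∣ : ∀ {a b c : Fin n} → a ≢ b → a ≢ c → b ≢ c → ∣ triple a b c ∣ ≡ 3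
∣triple∣ {a = a} {b} {c} a≢b a≢c b≢c = begin
  ∣ triple a b c ∣                           ≡⟨ ∣tabulate∣ (does ∘ triple? a b c) ⟩
  sum (λ x → ι (does (triple? a b c x)))     ≡⟨ sum-cong-≗ pointwise ⟩
  sum (λ x → δ a 1 x + (δ b 1 x + δ c 1 x))  ≡⟨ ∑-distrib-+ (δ a 1) _ ⟩
  sum (δ a 1) + sum (λ x → δ b 1 x + δ c 1 x) ≡⟨ cong (sum (δ a 1) +_) (∑-distrib-+ (δ b 1) (δ c 1)) ⟩
  sum (δ a 1) + (sum (δ b 1) + sum (δ c 1))  ≡⟨ cong₂ _+_ (sum-δ a 1) (cong₂ _+_ (sum-δ b 1) (sum-δ c 1)) ⟩
  3                                          ∎
  where
  open ≡-Reasoning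
  pointwise : ∀ x → ι (does (triple? a b c x)) ≡ δ a 1 x + (δ b 1 x + δ c 1 x)
  pointwise x with x ≟ a | x ≟ b | x ≟ c
  ... | yes refl | yes refl | _        = ⊥-elim (a≢b refl)
  ... | yes refl | no _     | yes refl = ⊥-elim (a≢c refl)
  ... | yes refl | no _     | no _     = refl
  ... | no _     | yes refl | yes refl = ⊥-elim (b≢c refl)
  ... | no _     | yes refl | no _     = refl
  ... | no _     | no _     | yes refl = refl
  ... | no _     | no _     | no _     = refl

cut-bounds-κ₃ : (G : Graph n) (C : Cut G) → (∃ λ w → w ≢ Cut.u C × w ≢ Cut.v C) →
  ∀ {c} → IsKappaK G 3 c → c ≤ ∣ Cut.separator C ∣
cut-bounds-κ₃ {n} G C (w , w≢u , w≢v) {c} (disconnected , _ , connected) =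
  decidable-stable (c ≤? ∣ separator ∣) λ ≰ →
    -- Connectedness is not decided. A connected graph satisfies the bound, so the refutation
    -- hypothesis makes the graph disconnected, where the convention gives `c ≡ 0`.
    ≰ (subst (_≤ ∣ separator ∣) (sym (disconnected λ conn → ≰ (from-tree-bound (proj₂ (connected conn large))))) z≤n)
  where
  open Cut C
  large : 3 ≤ n
  large = ≤-trans (≤-reflexive (sym (∣triple∣ u≢v (w≢u ∘ sym) (w≢v ∘ sym)))) (∣p∣≤n (triple u v w))
  bound-by : ∀ w → w ≢ u → w ≢ v → w ∉ separator ⊎ (∀ x → x ≢ u → x ≢ v → x ∈ separator) →
    (∀ S → ∣ S ∣ ≡ 3 → HasDisjointSTrees G S c) → c ≤ ∣ separator ∣
  bound-by w w≢u w≢v h trees = trees≤separator w (triple u v w)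
    (∈-triple⁺ (inj₁ refl)) (∈-triple⁺ (inj₂ (inj₁ refl))) (∈-triple⁺ (inj₂ (inj₂ refl))) w≢u w≢v (λ x → ∈-triple⁻) h
    (trees _ (∣triple∣ u≢v (w≢u ∘ sym) (w≢v ∘ sym)))
  from-tree-bound : (∀ S → ∣ S ∣ ≡ 3 → HasDisjointSTrees G S c) → c ≤ ∣ separator ∣
  from-tree-bound with any? (λ x → ¬? (x ≟ u) ×-dec ¬? (x ≟ v) ×-dec ¬? (x ∈? separator))
  ... | yes (x , x≢u , x≢v , x∉) = bound-by x x≢u x≢v (inj₁ x∉)
  ... | no none-left = bound-by w w≢u w≢v (inj₂ λ x x≢u x≢v → decidable-stable (x ∈? separator)
                         λ x∉ → none-left (x , x≢u , x≢v , x∉))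

-- Lexicographic products

sum-const : ∀ m c → sum {m} (λ _ → c) ≡ c * m
sum-const zero    c = sym (*-zeroʳ c)
sum-const (suc m) c = trans (cong (c +_) (sum-const m c)) (sym (*-suc c m))

sum-++ : ∀ m {l} (f : Fin (m + l) → ℕ) → sum f ≡ sum (λ i → f (i ↑ˡ l)) + sum (λ j → f (m ↑ʳ j))
sum-++ zero    f = refl
sum-++ (suc m) f = trans (cong (f zero +_) (sum-++ m (f ∘ suc))) (sym (+-assoc (f zero) _ _))

fibre : ∀ n m → Fin (n * m) → Fin n
fibre n m = proj₁ ∘ remQuot {n} m

sum-fibre : ∀ n m (f : Fin n → ℕ) → sum (f ∘ fibre n m) ≡ sum f * m
sum-fibre zero    m f = refl
sum-fibre (suc n) m f = begin
  sum (f ∘ fibre (suc n) m)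
    ≡⟨ sum-++ m (f ∘ fibre (suc n) m) ⟩
  sum (λ i → f (fibre (suc n) m (i ↑ˡ (n * m)))) + sum (λ j → f (fibre (suc n) m (m ↑ʳ j)))
    ≡⟨ cong₂ _+_ (sum-cong-≗ first) (sum-cong-≗ later) ⟩
  sum {m} (λ _ → f zero) + sum (f ∘ suc ∘ fibre n m)
    ≡⟨ cong₂ _+_ (sum-const m (f zero)) (sum-fibre n m (f ∘ suc)) ⟩
  f zero * m + sum (f ∘ suc) * m
    ≡⟨ *-distribʳ-+ m (f zero) _ ⟨
  (f zero + sum (f ∘ suc)) * m ∎
  where
  open ≡-Reasoning
  first : ∀ i → f (fibre (suc n) m (i ↑ˡ (n * m))) ≡ f zero
  first i rewrite splitAt-↑ˡ m i (n * m) = refl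
  later : ∀ j → f (fibre (suc n) m (m ↑ʳ j)) ≡ f (suc (fibre n m j))
  later j rewrite splitAt-↑ʳ m (n * m) j = refl

preimage : ∀ {n} m → Subset n → Subset (n * m)
preimage {n} m S = tabulate (lookup S ∘ fibre n m)

∣preimage∣ : ∀ {n} m (S : Subset n) → ∣ preimage m S ∣ ≡ ∣ S ∣ * m
∣preimage∣ {n} m S = begin
  ∣ preimage m S ∣                   ≡⟨ ∣tabulate∣ (lookup S ∘ fibre n m) ⟩
  sum (ι ∘ lookup S ∘ fibre n m)     ≡⟨ sum-fibre n m (ι ∘ lookup S) ⟩
  sum (ι ∘ lookup S) * m             ≡⟨ cong (_* m) (∣p∣≡sum S) ⟨
  ∣ S ∣ * m                          ∎
  where open ≡-Reasoning

∈-preimage⁺ : ∀ {n} m {S : Subset n} {x} → fibre n m x ∈ S → x ∈ preimage m S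
∈-preimage⁺ m h = ∈-tabulate⁺ ([]=⇒lookup h)

∈-preimage⁻ : ∀ {n} m {S : Subset n} {x} → x ∈ preimage m S → fibre n m x ∈ S
∈-preimage⁻ {n} m {S} {x} h = lookup⇒[]= (fibre n m x) S (∈-tabulate⁻ h)

fibre-combine : ∀ {n m} (i : Fin n) (j : Fin m) → fibre n m (combine i j) ≡ i
fibre-combine i j = cong proj₁ (remQuot-combine i j)

lex-fibre : ∀ {n m} (G : Graph n) (H : Graph m) x y → adj (G ∘ₗ H) x y ≡ true →
  adj G (fibre n m x) (fibre n m y) ≡ true ⊎ fibre n m x ≡ fibre n m y
lex-fibre {n} {m} G H x y e with adj G (fibre n m x) (fibre n m y) | fibre n m x ≟ fibre n m y
... | true  | _      = inj₁ refl
... | false | yes eq = inj₂ eq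

lex-cut : ∀ {n m} (G : Graph n) (H : Graph m) → Fin m → Cut G → Cut (G ∘ₗ H)
lex-cut {n} {m} G H h₀ C = record
  { separator = preimage m separator
  ; Side      = Side ∘ fibre n m
  ; u         = combine u h₀
  ; v         = combine v h₀
  ; u∉        = λ h → u∉ (subst (_∈ separator) (fibre-combine u h₀) (∈-preimage⁻ m h))
  ; v∉        = λ h → v∉ (subst (_∈ separator) (fibre-combine v h₀) (∈-preimage⁻ m h))
  ; u-side    = subst Side (sym (fibre-combine u h₀)) u-side
  ; v-side    = v-side ∘ subst Side (fibre-combine v h₀)
  ; closed    = λ x y x∉ y∉ e side → case lex-fibre G H x y e of λ where
      (inj₁ e′) → closed _ _ (x∉ ∘ ∈-preimage⁺ m) (y∉ ∘ ∈-preimage⁺ m) e′ side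
      (inj₂ eq) → subst Side eq side
  }
  where open Cut C

-- Vertex cuts of a non-complete graph

nonadjacent : (G : Graph n) → ¬ Complete G → ∃ λ a → ∃ λ b → a ≢ b × adj G a b ≡ false
nonadjacent G ¬complete with any? (λ a → any? λ b → ¬? (a ≟ b) ×-dec (adj G a b Bool.≟ false))
... | yes h = h
... | no ¬h = ⊥-elim (¬complete λ a b a≢b → Bool.¬-not λ e → ¬h (a , b , a≢b , e))

neighbour : (G : Graph n) → ∀ {X a b} → a ≢ b → Walk (adj G) X a b → ∃ λ c → adj G a c ≡ true
neighbour G a≢b (here _)     = ⊥-elim (a≢b refl)
neighbour G a≢b (step _ e _) = _ , e

avoid-two : ∀ {a b c : Fin n} → a ≢ b → a ≢ c → b ≢ c → ∀ u v → ∃ λ t → t ≢ u × t ≢ v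
avoid-two {a = a} {b} {c} a≢b a≢c b≢c u v with a ≟ u | a ≟ v | b ≟ u | b ≟ v
... | no a≢u   | no a≢v   | _        | _        = a , a≢u , a≢v
... | _        | _        | no b≢u   | no b≢v   = b , b≢u , b≢v
... | yes refl | _        | yes refl | _        = ⊥-elim (a≢b refl)
... | _        | yes refl | _        | yes refl = ⊥-elim (a≢b refl)
... | yes refl | _        | _        | yes refl = c , a≢c ∘ sym , b≢c ∘ sym
... | _        | yes refl | yes refl | _        = c , b≢c ∘ sym , a≢c ∘ sym

nonadjacent-cut : (G : Graph n) (a b : Fin n) → a ≢ b → adj G a b ≡ false → Cut G
nonadjacent-cut G a b a≢b ab = record
  -- `triple a b b` stands for the two-element set of `a` and `b`.
  { separator = ∁ (triple a b b)
  ; Side      = _≡ a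
  ; u         = a
  ; v         = b
  ; u∉        = λ h → x∈∁p⇒x∉p h (∈-triple⁺ (inj₁ refl))
  ; v∉        = λ h → x∈∁p⇒x∉p h (∈-triple⁺ {c = b} (inj₂ (inj₁ refl)))
  ; u-side    = refl
  ; v-side    = a≢b ∘ sym
  ; closed    = λ { _ y _ y∉ e refl → case ∈-triple⁻ (decidable-stable (y ∈? triple a b b) λ h → y∉ (x∉p⇒x∈∁p h)) of λ where
      (inj₁ y≡a)         → y≡a
      (inj₂ (inj₁ refl)) → ⊥-elim (true≢false e ab)
      (inj₂ (inj₂ refl)) → ⊥-elim (true≢false e ab) }
  }

∣∁∣<n : (S : Subset n) → ∀ {x} → x ∈ S → suc ∣ ∁ S ∣ ≤ n
∣∁∣<n {n} S {x} x∈S = ≤-trans (s≤s (p⊆q⇒∣p∣≤∣q∣ smaller)) (≤-trans strict (∣p∣≤n (⊤ {n})))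
  where
  smaller : ∁ S ⊆ ⊤ - x
  smaller y∈ = x∈p∧x≢y⇒x∈p-y ∈⊤ λ { refl → x∈∁p⇒x∉p y∈ x∈S }
  x∈⊤ : x ∈ ⊤
  x∈⊤ = ∈⊤
  strict : ∣ ⊤ {n} - x ∣ < ∣ ⊤ {n} ∣
  strict = x∈p⇒∣p-x∣<∣p∣ x∈⊤

walk-snoc : ∀ {E : BoolRel n} {X a b c} → Walk E X a b → E b c ≡ true → c ∈ X → Walk E X a c
walk-snoc (here h)     e c∈ = step h e (here c∈)
walk-snoc (step h f w) e c∈ = step h f (walk-snoc w e c∈)

-- The side is everything reachable from a vertex `a` that fails to reach some `b`. Such a pair is
-- found by excluded middle for reachability, assumed under double negation for all of the finitely
-- many pairs at once.
disconnected-cut : (G : Graph n) (S : Subset n) → ¬ ConnectedOn (adj G) (∁ S) →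
  ¬ ¬ (Σ (Cut G) λ C → Cut.separator C ≡ S)
disconnected-cut G S ¬conn ¬cut =
  ¬¬-sequence (λ a → ¬¬-sequence λ b → ¬¬-excluded-middle {A = Walk (adj G) (∁ S) a b}) λ walk? →
    ¬conn λ a b a∈ b∈ → case walk? a b of λ where
      (yes w) → w
      (no ¬w) → ⊥-elim (¬cut (record
        { separator = S
        ; Side      = Walk (adj G) (∁ S) a
        ; u         = a
        ; v         = b
        ; u∉        = x∈∁p⇒x∉p a∈
        ; v∉        = x∈∁p⇒x∉p b∈
        ; u-side    = here a∈
        ; v-side    = ¬w
        ; closed    = λ _ _ _ y∉ e w → walk-snoc w e (x∉p⇒x∈∁p y∉)
        } , refl))

-- A minimum separating set may leave at most one vertex and then has no two sides. In that case `k`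
-- is at least n - 1, and deleting all but two nonadjacent vertices gives a genuine cut that is no
-- larger.
connectivity-cut : (G : Graph n) → ¬ Complete G → ∀ {k} → IsConnectivity G k →
  ¬ ¬ (Σ (Cut G) λ C → ∣ Cut.separator C ∣ ≤ k)
connectivity-cut {n} G ¬complete ((S , refl , inj₁ small) , _) ¬cut with nonadjacent G ¬complete
... | a , b , a≢b , ab = ¬cut (nonadjacent-cut G a b a≢b ab ,
  s≤s⁻¹ (≤-trans (∣∁∣<n (triple a b b) (∈-triple⁺ {a = a} (inj₁ refl)))
    (n≤1+∣S∣ (subst (_≤ 1) (∣∁p∣≡n∸∣p∣ S) small))))
  where
  n≤1+∣S∣ : n ∸ ∣ S ∣ ≤ 1 → n ≤ suc ∣ S ∣
  n≤1+∣S∣ h = ≤-trans (m≤n+m∸n n ∣ S ∣) (≤-trans (+-monoʳ-≤ ∣ S ∣ h) (≤-reflexive (+-comm ∣ S ∣ 1)))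
connectivity-cut G ¬complete ((S , refl , inj₂ ¬conn) , _) ¬cut =
  disconnected-cut G S ¬conn λ { (C , refl) → ¬cut (C , ≤-refl) }

upper-bound : (n m : ℕ) (G : Graph n) (H : Graph m) →
  2 ≤ n → 1 ≤ m → Connected G → Connected H → ¬ Complete G →
  (k c c' : ℕ) → IsConnectivity G k → IsKappaK G 3 c → IsKappaK (G ∘ₗ H) 3 c' →
  c' ≤ bound c (k % 4) * m
upper-bound n (suc m) G H _ _ connG _ ¬complete k c c' conn@(_ , min) (_ , _ , κG) κGH
  with nonadjacent G ¬complete
-- A neighbour of `a` is a third vertex besides `a` and `b`. Thus κ₃(G) is not governed by the
-- convention for small graphs, and every lifted cut has a vertex other than its `u` and `v`.
... | a , b , a≢b , ab with neighbour G a≢b (connG a b ∈⊤ ∈⊤)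
...   | d , ad = decidable-stable (c' ≤? bound c (k % 4) * suc m) λ ≰ →
  connectivity-cut G ¬complete conn λ { (C , sep≤k) → ≰ (begin
    c'                                           ≤⟨ cut-bounds-κ₃ (G ∘ₗ H) (lex-cut G H zero C) (fresh C) κGH ⟩
    ∣ preimage (suc m) (Cut.separator C) ∣       ≡⟨ ∣preimage∣ (suc m) (Cut.separator C) ⟩
    ∣ Cut.separator C ∣ * suc m                  ≤⟨ *-monoˡ-≤ (suc m) (≤-trans sep≤k (treeCount⇒bound k c k≤c)) ⟩
    bound c (k % 4) * suc m                      ∎) }
  where
  open ≤-Reasoning
  a≢d : a ≢ d
  a≢d refl = true≢false ad (adj-irrefl G a)
  b≢d : b ≢ d
  b≢d refl = true≢false ad ab
  large : 3 ≤ n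
  large = ≤-trans (≤-reflexive (sym (∣triple∣ a≢b a≢d b≢d))) (∣p∣≤n (triple a b d))
  k≤c : treeCount k ≤ c
  k≤c = let (S , ∣S∣≡3 , κS) , _ = κG connG large in treeCount≤κ G min S ∣S∣≡3 κS
  fresh : ∀ C → let open Cut (lex-cut G H zero C) in ∃ λ w → w ≢ u × w ≢ v
  fresh C = let t , t≢u , t≢v = avoid-two a≢b a≢d b≢d (Cut.u C) (Cut.v C) in
    combine t zero , away t≢u , away t≢v
    where
    away : ∀ {t u} → t ≢ u → combine t (zero {m}) ≢ combine u zero
    away {t} {u} t≢u e = t≢u (trans (sym (fibre-combine t zero)) (trans (cong (fibre n (suc m)) e) (fibre-combine u zero)))

-- Sharpness: the path on three vertices

path : BoolRel 3
path 0F 1F = true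
path 1F 0F = true
path 1F 2F = true
path 2F 1F = true
path _  _  = false

P₃ : Graph 3
P₃ = record
  { adj = path
  ; adj-sym = λ { 0F 0F → refl ; 0F 1F → refl ; 0F 2F → refl ; 1F 0F → refl ; 1F 1F → refl ; 1F 2F → refl
                ; 2F 0F → refl ; 2F 1F → refl ; 2F 2F → refl }
  ; adj-irrefl = λ { 0F → refl ; 1F → refl ; 2F → refl }
  }

K₁ : Graph 1
K₁ = record { adj = λ _ _ → false ; adj-sym = λ _ _ → refl ; adj-irrefl = λ _ → refl }

path-middle : ∀ x y z → path x y ≡ true → path y z ≡ true → x ≢ z → y ≡ 1F × x ≢ 1F × z ≢ 1F
path-middle 0F 1F 0F _ _ h = ⊥-elim (h refl)
path-middle 0F 1F 2F _ _ _ = refl , (λ ()) , λ ()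
path-middle 2F 1F 0F _ _ _ = refl , (λ ()) , λ ()
path-middle 2F 1F 2F _ _ h = ⊥-elim (h refl)
path-middle 1F 0F 1F _ _ h = ⊥-elim (h refl)
path-middle 1F 2F 1F _ _ h = ⊥-elim (h refl)

path-end : ∀ z w → z ≢ 1F → path z w ≡ true → w ≡ 1F
path-end 0F 1F _ _ = refl
path-end 2F 1F _ _ = refl
path-end 1F _  h _ = ⊥-elim (h refl)

-- Adjacency is required to agree with `path` only pointwise, so that the results apply both to `P₃`
-- and to its product with `K₁`.
module _ (G : Graph 3) (adj≡path : ∀ u v → adj G u v ≡ path u v) where

  to-path : ∀ {u v} → adj G u v ≡ true → path u v ≡ true
  to-path {u} {v} e = trans (sym (adj≡path u v)) e

  path-connected : Connected G
  path-connected u v _ _ = walk u v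
    where
    hop : ∀ u v {w} → path u v ≡ true → Walk (adj G) ⊤ v w → Walk (adj G) ⊤ u w
    hop u v e = step ∈⊤ (trans (adj≡path u v) e)
    walk : ∀ u v → Walk (adj G) ⊤ u v
    walk 0F 0F = here ∈⊤
    walk 0F 1F = hop 0F 1F refl (here ∈⊤)
    walk 0F 2F = hop 0F 1F refl (hop 1F 2F refl (here ∈⊤))
    walk 1F 0F = hop 1F 0F refl (here ∈⊤)
    walk 1F 1F = here ∈⊤
    walk 1F 2F = hop 1F 2F refl (here ∈⊤)
    walk 2F 0F = hop 2F 1F refl (hop 1F 0F refl (here ∈⊤))
    walk 2F 1F = hop 2F 1F refl (here ∈⊤)
    walk 2F 2F = here ∈⊤

  -- The middle of three distinct consecutive vertices is the centre. The vertex after them, being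
  -- adjacent to an end of the path, is the centre again, so the would-be cycle either repeats a
  -- vertex or closes at the wrong one.
  path-acyclic : ¬ Cycle (adj G)
  path-acyclic (x , [] , () , _)
  path-acyclic (x , y ∷ [] , s≤s () , _)
  path-acyclic (x , y ∷ z ∷ rest , _ , (_ ∷ x≢z ∷ _) ∷ ((_ ∷ y∉) ∷ _) , (xy ∷ yz ∷ linked))
    with path-middle x y z (to-path xy) (to-path yz) x≢z
  path-acyclic (x , y ∷ z ∷ [] , _ , _ , (_ ∷ _ ∷ zx ∷ _)) | refl , x≢1 , z≢1 =
    x≢1 (path-end z x z≢1 (to-path zx))
  path-acyclic (x , y ∷ z ∷ w ∷ _ , _ , (_ ∷ ((_ ∷ (y≢w ∷ _)) ∷ _)) , (_ ∷ _ ∷ zw ∷ _)) | refl , x≢1 , z≢1 =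
    y≢w (sym (path-end z w z≢1 (to-path zw)))

  path-cut : Cut G
  path-cut = record
    { separator = false ∷ true ∷ false ∷ []
    ; Side      = _≡ 0F
    ; u         = 0F
    ; v         = 2F
    ; u∉        = λ ()
    ; v∉        = λ { (there (there ())) }
    ; u-side    = refl
    ; v-side    = λ ()
    ; closed    = λ { _ y _ y∉ e refl → case path-end 0F y (λ ()) (to-path e) of λ { refl → ⊥-elim (y∉ (there here)) } }
    }

  path-tree : ∀ S → HasDisjointSTrees G S 1
  path-tree S = (λ _ → whole) , (λ _ → (path-connected , path-acyclic) , λ _ → ∈⊤) , λ { 0F 0F h → ⊥-elim (h refl) }
    where
    whole : Subgraph G
    whole = record { VT = ⊤ ; ET = adj G ; ET-sym = adj-sym G ; ET-adj = λ _ _ e → e ; ET-inˡ = λ _ _ _ → ∈⊤ }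

  path-κ₃ : IsKappaK G 3 1
  path-κ₃ = (λ ¬conn → ⊥-elim (¬conn path-connected)) , (λ _ → λ { (s≤s (s≤s (s≤s ()))) }) , λ _ _ →
    (⊤ , refl , path-tree ⊤ , λ ℓ → Cut.trees≤separator path-cut 1F ⊤ ∈⊤ ∈⊤ ∈⊤ (λ ()) (λ ())
      (λ { 0F _ → inj₁ refl ; 1F _ → inj₂ (inj₂ refl) ; 2F _ → inj₂ (inj₁ refl) })
      -- The third terminal is the separator itself, so the second alternative applies.
      (inj₂ λ { 0F h _ → ⊥-elim (h refl) ; 1F _ _ → there here ; 2F _ h → ⊥-elim (h refl) })) ,
    λ S _ → path-tree S

P₃-connectivity : IsConnectivity P₃ 1
P₃-connectivity = (separator , refl , inj₂ λ conn → case walk-invariant (_≡ 0F) stays (conn 0F 2F here (there (there here))) refl of λ ()) , min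
  where
  separator : Subset 3
  separator = false ∷ true ∷ false ∷ []
  stays : ∀ u v → u ∈ ∁ separator → v ∈ ∁ separator → path u v ≡ true → u ≡ 0F → v ≡ 0F
  stays _ 0F _ _ _ refl = refl
  stays _ 1F _ (there ()) _ refl
  min : ∀ S → Separating P₃ S → 1 ≤ ∣ S ∣
  min (true ∷ _) _ = s≤s z≤n
  min (false ∷ true ∷ _) _ = s≤s z≤n
  min (false ∷ false ∷ true ∷ []) _ = s≤s z≤n
  min (false ∷ false ∷ false ∷ []) (inj₁ (s≤s ()))
  min (false ∷ false ∷ false ∷ []) (inj₂ ¬conn) = ⊥-elim (¬conn (path-connected P₃ (λ _ _ → refl)))

theorem1p10 : ((n m : ℕ) (G : Graph n) (H : Graph m) →
    2 ≤ n → 1 ≤ m → Connected G → Connected H → ¬ Complete G →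
    (k c c' : ℕ) → IsConnectivity G k → IsKappaK G 3 c → IsKappaK (G ∘ₗ H) 3 c' →
    c' ≤ bound c (k % 4) * m)
    ×
    (Σ ℕ λ n → Σ ℕ λ m → Σ (Graph n) λ G → Σ (Graph m) λ H →
    2 ≤ n × 1 ≤ m × Connected G × Connected H × ¬ Complete G ×
    (Σ ℕ λ k → Σ ℕ λ c → Σ ℕ λ c' →
    IsConnectivity G k × IsKappaK G 3 c × IsKappaK (G ∘ₗ H) 3 c' ×
    c' ≡ bound c (k % 4) * m))
theorem1p10 = upper-bound ,
  (3 , 1 , P₃ , K₁ , s≤s (s≤s z≤n) , ≤-refl , path-connected P₃ (λ _ _ → refl) , (λ { 0F 0F _ _ → here here }) ,
    -- With k = c = 1 and r = 1 the numerator of `bound` is 4 + 3 - 4 = 3, so the bound is 1.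
    (λ complete → case complete 0F 2F (λ ()) of λ ()) , 1 , 1 , 1 , P₃-connectivity ,
    path-κ₃ P₃ (λ _ _ → refl) ,
    path-κ₃ (P₃ ∘ₗ K₁) (λ { 0F 0F → refl ; 0F 1F → refl ; 0F 2F → refl ; 1F 0F → refl ; 1F 1F → refl ; 1F 2F → refl
                          ; 2F 0F → refl ; 2F 1F → refl ; 2F 2F → refl }) ,
    refl)
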